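{- Let $d\ge1$ and consider a generic finite collection of affine functions $h_i\colon\mathbb{R}^d\to\mathbb{R}$, $h_i(x)=\langle x,g_i\rangle+c_i$ with $g_i\neq0$. If every chamber of the decomposition of $\mathbb{R}^d$ defined by the hyperplanes $h_i^{ -1}(0)$ has heft at least $k$, then the number of chambers with heft exactly $k$ is at most $\binom{d+k}{d}$.
   Context: The hyperplanes $h_i^{ -1}(0)$ decompose $\mathbb{R}^d$ into cells; a chamber is a $d$-dimensional cell. The negative side of the $i$-th hyperplane is $h_i^{ -1}(-\infty,0]$ and its positive side is $h_i^{ -1}[0,\infty)$. The heft of a chamber is the number of hyperplanes that contain the chamber on their positive side. The collection is generic if, for each $1\le p\le d$, at most $p$ of the hyperplanes contain a common $(d-p)$-dimensional affine subspace (in particular at most $d$ hyperplanes pass through any point). -}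

module Defs where

open import Level using (Level; 0ℓ) renaming (suc to lsuc)
open import Data.Nat using (ℕ; zero; suc; _≤_; _∸_)
open import Data.Nat.Combinatorics using (_C_)
open import Data.Fin using (Fin)
open import Data.Bool using (Bool; true; false)
open import Data.Vec using (Vec; []; _∷_; lookup)
open import Data.List using (List; length)
open import Data.List.Relation.Unary.All using (All)
open import Data.List.Relation.Unary.Unique.Propositional using (Unique)
open import Data.Product using (Σ; ∃; _×_; _,_)
open import Data.Sum using (_⊎_)
open import Function using (Injective)
open import Relation.Binary.PropositionalEquality using (_≡_; _≢_)
open import Relation.Nullary using (¬_)

-- An axiomatic model of the real numbers: a complete ordered field.
-- (agda-stdlib has no reals, so the theorem is quantified over every
-- structure satisfying the axioms of ℝ; the real numbers are one.)

record RealField : Set₁ where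
  infixl 6 _+ᵣ_
  infixl 7 _*ᵣ_
  infix  4 _<ᵣ_
  field
    ℝ    : Set
    0r 1r : ℝ
    _+ᵣ_ _*ᵣ_ : ℝ → ℝ → ℝ
    -_  : ℝ → ℝ
    inv : (x : ℝ) → x ≢ 0r → ℝ
    _<ᵣ_ : ℝ → ℝ → Set
    +-assoc : ∀ x y z → (x +ᵣ y) +ᵣ z ≡ x +ᵣ (y +ᵣ z)
    +-comm  : ∀ x y → x +ᵣ y ≡ y +ᵣ x
    +-idˡ   : ∀ x → 0r +ᵣ x ≡ x
    -‿invˡ  : ∀ x → (- x) +ᵣ x ≡ 0r
    *-assoc : ∀ x y z → (x *ᵣ y) *ᵣ z ≡ x *ᵣ (y *ᵣ z)
    *-comm  : ∀ x y → x *ᵣ y ≡ y *ᵣ x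
    *-idˡ   : ∀ x → 1r *ᵣ x ≡ x
    distribˡ : ∀ x y z → x *ᵣ (y +ᵣ z) ≡ (x *ᵣ y) +ᵣ (x *ᵣ z)
    inv-invˡ : ∀ x (p : x ≢ 0r) → inv x p *ᵣ x ≡ 1r
    0≢1     : 0r ≢ 1r
    <-irrefl : ∀ x → ¬ (x <ᵣ x)
    <-trans  : ∀ {x y z} → x <ᵣ y → y <ᵣ z → x <ᵣ z
    <-tri    : ∀ x y → x <ᵣ y ⊎ (x ≡ y ⊎ y <ᵣ x)
    +-mono-< : ∀ {x y} z → x <ᵣ y → x +ᵣ z <ᵣ y +ᵣ z
    *-pos    : ∀ {x y} → 0r <ᵣ x → 0r <ᵣ y → 0r <ᵣ x *ᵣ y
    lub : (S : ℝ → Set) → (∃ λ x → S x) → (∃ λ b → ∀ x → S x → ¬ (b <ᵣ x)) →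
          Σ ℝ λ s → (∀ x → S x → ¬ (s <ᵣ x)) ×
                    (∀ b → (∀ x → S x → ¬ (b <ᵣ x)) → ¬ (b <ᵣ s))

module Arrangement (F : RealField) where
  open RealField F

  Pt : ℕ → Set
  Pt d = Fin d → ℝ

  Σ[_] : ∀ m → (Fin m → ℝ) → ℝ
  Σ[ zero ] f = 0r
  Σ[ suc m ] f = f Fin.zero +ᵣ Σ[ m ] (λ j → f (Fin.suc j))

  ⟨_,_⟩ : ∀ {d} → Pt d → Pt d → ℝ
  ⟨_,_⟩ {d} x y = Σ[ d ] (λ j → x j *ᵣ y j)

  h : ∀ {n d} → (Fin n → Pt d) → (Fin n → ℝ) → Fin n → Pt d → ℝ
  h g c i x = ⟨ x , g i ⟩ +ᵣ c i

  LinIndep : ∀ {m d} → (Fin m → Pt d) → Set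
  LinIndep {m} {d} v =
    (a : Fin m → ℝ) → (∀ j → Σ[ m ] (λ k → a k *ᵣ v k j) ≡ 0r) → ∀ k → a k ≡ 0r

  -- the hyperplane h_i^{-1}(0) contains the (d-p)-dim affine subspace
  -- x0 + span(v_1,…,v_{d-p})
  Contains : ∀ {n d m} → (Fin n → Pt d) → (Fin n → ℝ) → Fin n →
             Pt d → (Fin m → Pt d) → Set
  Contains g c i x0 v = h g c i x0 ≡ 0r × (∀ k → ⟨ v k , g i ⟩ ≡ 0r)

  Generic : ∀ {n} d → (Fin n → Pt d) → (Fin n → ℝ) → Set
  Generic {n} d g c =
    ∀ p → 1 ≤ p → p ≤ d →
    (x0 : Pt d) (v : Fin (d ∸ p) → Pt d) → LinIndep v →
    (f : Fin (suc p) → Fin n) → Injective _≡_ _≡_ f →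
    ¬ (∀ t → Contains g c (f t) x0 v)

  -- a chamber, recorded by its sign vector σ (true = positive side):
  -- σ is a chamber iff the open cell {x | sign h_i(x) = σ_i ∀ i} is nonempty
  SideOf : Bool → ℝ → Set
  SideOf true  r = 0r <ᵣ r
  SideOf false r = r <ᵣ 0r

  IsChamber : ∀ {n d} → (Fin n → Pt d) → (Fin n → ℝ) → Vec Bool n → Set
  IsChamber {d = d} g c σ = ∃ λ (x : Pt d) → ∀ i → SideOf (lookup σ i) (h g c i x)

-- heft: number of hyperplanes having the chamber on their positive side
heft : ∀ {n} → Vec Bool n → ℕ
heft [] = 0
heft (true ∷ σ) = suc (heft σ)
heft (false ∷ σ) = heft σ

{-# OPTIONS --safe #-}
-- For a chamber A of minimal heft k let f_A be the product of the k affine functions that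
-- are positive on A, a polynomial of degree at most k in d variables, and let y_A be the
-- point closest to the origin in the polyhedron where all other functions are nonpositive.
-- By genericity the normals of the hyperplanes through y_A are linearly independent, so
-- moving y_A slightly makes all of these functions negative; minimality of k then shows
-- that A is exactly the set of functions positive at y_A.  If f_B(y_A) ≠ 0, then y_B lies in
-- the tangent cone at y_A, so y_B is farther from the origin than y_A unless A = B.
-- The matrix f_B(y_A) is thus triangular with nonzero diagonal, the f_A are linearly
-- independent, and their number is at most the dimension of the space of polynomials.
module Submission where

open import Defs
open import Algebra.Bundles using (CommutativeRing)
import Algebra.Properties.Ring
import Algebra.Solver.Ring
open import Algebra.Solver.Ring.AlmostCommutativeRing
  using (fromCommutativeRing; _-Raw-AlmostCommutative⟶_)
open import Data.Bool using (Bool; true; false)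
import Data.Bool.Properties as Bool
open import Data.Empty using (⊥-elim)
open import Data.Fin as Fin using (Fin; zero; suc; punchIn; punchOut; _↑ˡ_; _↑ʳ_)
import Data.Fin.Properties as Fin
open import Data.Integer as ℤ using (ℤ; +_; -[1+_])
import Data.Integer.Properties as ℤ
open import Data.List as List using (List; []; _∷_; length; filter; allFin)
open import Data.List.Membership.Propositional using (_∈_)
open import Data.List.Membership.Propositional.Properties using (∈-filter⁺; ∈-allFin; ∈-lookup)
import Data.List.Properties as List
open import Data.List.Relation.Unary.All as All using (All; []; _∷_)
import Data.List.Relation.Unary.All.Properties as All
open import Data.List.Relation.Unary.AllPairs using ([]; _∷_)
open import Data.List.Relation.Unary.Unique.Propositional using (Unique)
import Data.List.Relation.Unary.Unique.Propositional.Properties as Unique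
open import Data.Maybe using (Maybe; just; nothing)
open import Data.Nat as ℕ using (ℕ; zero; suc; z≤n; s≤s; _+_; _∸_; _≤_)
open import Data.Nat.Combinatorics using (_C_; nCn≡1; nCk+nC[k+1]≡[n+1]C[k+1])
import Data.Nat.Properties as ℕ
open import Data.Product using (∃; _×_; _,_; proj₁; proj₂)
open import Data.Sum using (_⊎_; inj₁; inj₂)
open import Data.Vec using (Vec; []; _∷_; tabulate; lookup)
open import Data.Vec.Functional using (_++_)
open import Data.Vec.Functional.Properties using (lookup-++ˡ; lookup-++ʳ)
import Data.Vec.Properties as Vec
open import Function using (id; _∘_; Injective)
open import Relation.Binary.PropositionalEquality
open import Relation.Nullary
open import Relation.Nullary.Decidable using (dec-true; dec-false; _×-dec_)

-- The existence of the closest point y_A, usually a compactness argument, is proved by induction on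
-- the inequalities. If the closest point for the others violates one of them, that one becomes an
-- equation; when no inequalities are left, the closest point is an orthogonal projection. A
-- hyperplane through y_A that has B on its positive side contributes a zero factor to f_B(y_A). If
-- there is none, every function vanishing at y_A is nonpositive at y_B, which is the tangent cone
-- condition. Optimality of y_A then reads ⟨y_A, y_B - y_A⟩ ≥ 0, and expanding |y_B|² around y_A
-- gives |y_B|² ≥ |y_A|² + |y_B - y_A|². So f_B(y_A) vanishes also for B ≠ A with |y_B| = |y_A|, and
-- ties in the ordering by norm do no harm to the triangular shape.

module RealProperties (F : RealField) where
  open RealField F public renaming (-_ to infix 8 -_)
  open Arrangement F public

  -- The field as a commutative ring, and a ring solver with integer coefficients.

  commutativeRing : CommutativeRing _ _
  commutativeRing = record
    { Carrier = ℝ ; _≈_ = _≡_ ; _+_ = _+ᵣ_ ; _*_ = _*ᵣ_ ; -_ = -_ ; 0# = 0r ; 1# = 1r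
    ; isCommutativeRing = record
      { *-comm = *-comm
      ; isRing = record
        { +-isAbelianGroup = record
          { comm = +-comm
          ; isGroup = record
            { inverse = -‿invˡ , λ x → trans (+-comm x (- x)) (-‿invˡ x)
            ; ⁻¹-cong = cong (-_)
            ; isMonoid = record
              { identity = +-idˡ , λ x → trans (+-comm x 0r) (+-idˡ x)
              ; isSemigroup = record
                { assoc = +-assoc
                ; isMagma = record { isEquivalence = isEquivalence ; ∙-cong = cong₂ _+ᵣ_ } } } } }
        ; *-cong = cong₂ _*ᵣ_
        ; *-assoc = *-assoc
        ; *-identity = *-idˡ , λ x → trans (*-comm x 1r) (*-idˡ x)
        ; distrib = distribˡ , λ x y z → trans (*-comm (y +ᵣ z) x)
            (trans (distribˡ x y z) (cong₂ _+ᵣ_ (*-comm x y) (*-comm x z)))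
        } } }

  open CommutativeRing commutativeRing public
    using (+-identityʳ; *-identityʳ; zeroˡ; zeroʳ; distribʳ; ring; -‿inverseʳ)
  open Algebra.Properties.Ring ring
    using (-‿distribˡ-*; -‿involutive; -0#≈0#; -‿+-comm)

  -- The separate clause for one makes `fromℤ (+ 1)` reduce to `1r`, so that `con (+ 1)` in a solver
  -- equation is literally `1r` and not `1r +ᵣ 0r`.
  fromℕ : ℕ → ℝ
  fromℕ zero = 0r
  fromℕ (suc zero) = 1r
  fromℕ (suc (suc n)) = 1r +ᵣ fromℕ (suc n)

  fromℤ : ℤ → ℝ
  fromℤ (+ n) = fromℕ n
  fromℤ (-[1+ n ]) = - fromℕ (suc n)

  private
    open ≡-Reasoning

    fromℕ-suc : ∀ n → fromℕ (suc n) ≡ 1r +ᵣ fromℕ n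
    fromℕ-suc zero = sym (+-identityʳ 1r)
    fromℕ-suc (suc n) = refl

    fromℕ-+ : ∀ m n → fromℕ (m ℕ.+ n) ≡ fromℕ m +ᵣ fromℕ n
    fromℕ-+ zero n = sym (+-idˡ _)
    fromℕ-+ (suc m) n = begin
      fromℕ (suc (m ℕ.+ n))             ≡⟨ fromℕ-suc (m ℕ.+ n) ⟩
      1r +ᵣ fromℕ (m ℕ.+ n)             ≡⟨ cong (1r +ᵣ_) (fromℕ-+ m n) ⟩
      1r +ᵣ (fromℕ m +ᵣ fromℕ n)        ≡⟨ sym (+-assoc _ _ _) ⟩
      1r +ᵣ fromℕ m +ᵣ fromℕ n          ≡⟨ cong (_+ᵣ fromℕ n) (sym (fromℕ-suc m)) ⟩
      fromℕ (suc m) +ᵣ fromℕ n          ∎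

    cancel-one : ∀ a b → a +ᵣ - b ≡ (1r +ᵣ a) +ᵣ - (1r +ᵣ b)
    cancel-one a b = sym (begin
      (1r +ᵣ a) +ᵣ - (1r +ᵣ b)     ≡⟨ cong₂ _+ᵣ_ (+-comm 1r a) (sym (-‿+-comm 1r b)) ⟩
      (a +ᵣ 1r) +ᵣ (- 1r +ᵣ - b)   ≡⟨ +-assoc a 1r _ ⟩
      a +ᵣ (1r +ᵣ (- 1r +ᵣ - b))   ≡⟨ cong (a +ᵣ_) (sym (+-assoc 1r (- 1r) _)) ⟩
      a +ᵣ ((1r +ᵣ - 1r) +ᵣ - b)   ≡⟨ cong (λ z → a +ᵣ (z +ᵣ - b)) (-‿inverseʳ 1r) ⟩
      a +ᵣ (0r +ᵣ - b)             ≡⟨ cong (a +ᵣ_) (+-idˡ _) ⟩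
      a +ᵣ - b                     ∎)

    fromℤ-⊖ : ∀ m n → fromℤ (m ℤ.⊖ n) ≡ fromℕ m +ᵣ - fromℕ n
    fromℤ-⊖ m zero = sym (trans (cong (fromℕ m +ᵣ_) -0#≈0#) (+-identityʳ _))
    fromℤ-⊖ zero (suc n) = sym (+-idˡ _)
    fromℤ-⊖ (suc m) (suc n) = begin
      fromℤ (suc m ℤ.⊖ suc n)                ≡⟨ cong fromℤ (ℤ.[1+m]⊖[1+n]≡m⊖n m n) ⟩
      fromℤ (m ℤ.⊖ n)                        ≡⟨ fromℤ-⊖ m n ⟩
      fromℕ m +ᵣ - fromℕ n                   ≡⟨ cancel-one _ _ ⟩
      (1r +ᵣ fromℕ m) +ᵣ - (1r +ᵣ fromℕ n)   ≡⟨ sym (cong₂ (λ a b → a +ᵣ - b) (fromℕ-suc m) (fromℕ-suc n)) ⟩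
      fromℕ (suc m) +ᵣ - fromℕ (suc n)       ∎

    fromℤ-+ : ∀ i j → fromℤ (i ℤ.+ j) ≡ fromℤ i +ᵣ fromℤ j
    fromℤ-+ (+ m) (+ n) = fromℕ-+ m n
    fromℤ-+ (+ m) (-[1+ n ]) = fromℤ-⊖ m (suc n)
    fromℤ-+ (-[1+ m ]) (+ n) = trans (fromℤ-⊖ n (suc m)) (+-comm _ _)
    fromℤ-+ (-[1+ m ]) (-[1+ n ]) = begin
      - fromℕ (suc (suc (m ℕ.+ n)))           ≡⟨ cong (λ k → - fromℕ (suc k)) (sym (ℕ.+-suc m n)) ⟩
      - fromℕ (suc m ℕ.+ suc n)               ≡⟨ cong -_ (fromℕ-+ (suc m) (suc n)) ⟩
      - (fromℕ (suc m) +ᵣ fromℕ (suc n))      ≡⟨ sym (-‿+-comm _ _) ⟩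
      - fromℕ (suc m) +ᵣ - fromℕ (suc n)      ∎

    fromℤ-neg : ∀ i → fromℤ (ℤ.- i) ≡ - fromℤ i
    fromℤ-neg (+ zero) = sym -0#≈0#
    fromℤ-neg (+ suc n) = refl
    fromℤ-neg (-[1+ n ]) = sym (-‿involutive _)

    fromℤ-*⁺ : ∀ m j → fromℤ (+ m ℤ.* j) ≡ fromℕ m *ᵣ fromℤ j
    fromℤ-*⁺ zero j = sym (zeroˡ _)
    fromℤ-*⁺ (suc m) j = begin
      fromℤ (+ suc m ℤ.* j)                      ≡⟨ cong fromℤ (ℤ.suc-* (+ m) j) ⟩
      fromℤ (j ℤ.+ + m ℤ.* j)                    ≡⟨ fromℤ-+ j (+ m ℤ.* j) ⟩
      fromℤ j +ᵣ fromℤ (+ m ℤ.* j)               ≡⟨ cong₂ _+ᵣ_ (sym (*-idˡ _)) (fromℤ-*⁺ m j) ⟩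
      1r *ᵣ fromℤ j +ᵣ fromℕ m *ᵣ fromℤ j        ≡⟨ sym (distribʳ _ _ _) ⟩
      (1r +ᵣ fromℕ m) *ᵣ fromℤ j                 ≡⟨ cong (_*ᵣ fromℤ j) (sym (fromℕ-suc m)) ⟩
      fromℕ (suc m) *ᵣ fromℤ j                   ∎

    fromℤ-* : ∀ i j → fromℤ (i ℤ.* j) ≡ fromℤ i *ᵣ fromℤ j
    fromℤ-* (+ m) j = fromℤ-*⁺ m j
    fromℤ-* (-[1+ m ]) j = begin
      fromℤ (ℤ.- (+ suc m) ℤ.* j)       ≡⟨ cong fromℤ (sym (ℤ.neg-distribˡ-* (+ suc m) j)) ⟩
      fromℤ (ℤ.- (+ suc m ℤ.* j))       ≡⟨ fromℤ-neg (+ suc m ℤ.* j) ⟩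
      - fromℤ (+ suc m ℤ.* j)           ≡⟨ cong -_ (fromℤ-*⁺ (suc m) j) ⟩
      - (fromℕ (suc m) *ᵣ fromℤ j)      ≡⟨ -‿distribˡ-* _ _ ⟩
      - fromℕ (suc m) *ᵣ fromℤ j        ∎

    almostCommutativeRing = fromCommutativeRing commutativeRing

    -- The solver has to compute with its coefficients. Integer arithmetic and equality reduce on
    -- literals, whereas a test through the axiom `<-tri` would be stuck.
    homomorphism : CommutativeRing.rawRing ℤ.+-*-commutativeRing
                   -Raw-AlmostCommutative⟶ almostCommutativeRing
    homomorphism = record
      { ⟦_⟧ = fromℤ
      ; +-homo = fromℤ-+
      ; *-homo = fromℤ-*
      ; -‿homo = fromℤ-neg
      ; 0-homo = refl
      ; 1-homo = refl
      }

    equal? : ∀ i j → Maybe (fromℤ i ≡ fromℤ j)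
    equal? i j with i ℤ.≟ j
    ... | yes i≡j = just (cong fromℤ i≡j)
    ... | no _ = nothing

  module Solver = Algebra.Solver.Ring
    (CommutativeRing.rawRing ℤ.+-*-commutativeRing) almostCommutativeRing homomorphism equal?
  open Solver using (solve; _:=_; _:+_; _:*_; :-_; con)

  -- Order properties of the field.

  infix 4 _≤ᵣ_
  _≤ᵣ_ : ℝ → ℝ → Set
  x ≤ᵣ y = ¬ (y <ᵣ x)

  _≟ᵣ_ : (x y : ℝ) → Dec (x ≡ y)
  x ≟ᵣ y with <-tri x y
  ... | inj₁ x<y = no λ { refl → <-irrefl _ x<y }
  ... | inj₂ (inj₁ x≡y) = yes x≡y
  ... | inj₂ (inj₂ y<x) = no λ { refl → <-irrefl _ y<x }

  _<?_ : (x y : ℝ) → Dec (x <ᵣ y)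
  x <? y with <-tri x y
  ... | inj₁ x<y = yes x<y
  ... | inj₂ (inj₁ refl) = no (<-irrefl _)
  ... | inj₂ (inj₂ y<x) = no λ x<y → <-irrefl _ (<-trans x<y y<x)

  ≤⇒<⊎≡ : ∀ {x y} → x ≤ᵣ y → x <ᵣ y ⊎ x ≡ y
  ≤⇒<⊎≡ {x} {y} x≤y with <-tri x y
  ... | inj₁ x<y = inj₁ x<y
  ... | inj₂ (inj₁ x≡y) = inj₂ x≡y
  ... | inj₂ (inj₂ y<x) = ⊥-elim (x≤y y<x)

  <⇒≤ : ∀ {x y} → x <ᵣ y → x ≤ᵣ y
  <⇒≤ x<y y<x = <-irrefl _ (<-trans x<y y<x)

  ≤-reflexive : ∀ {x y} → x ≡ y → x ≤ᵣ y
  ≤-reflexive refl = <-irrefl _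

  <-≤-trans : ∀ {x y z} → x <ᵣ y → y ≤ᵣ z → x <ᵣ z
  <-≤-trans x<y y≤z with ≤⇒<⊎≡ y≤z
  ... | inj₁ y<z = <-trans x<y y<z
  ... | inj₂ refl = x<y

  ≤-<-trans : ∀ {x y z} → x ≤ᵣ y → y <ᵣ z → x <ᵣ z
  ≤-<-trans x≤y y<z with ≤⇒<⊎≡ x≤y
  ... | inj₁ x<y = <-trans x<y y<z
  ... | inj₂ refl = y<z

  ≤-trans : ∀ {x y z} → x ≤ᵣ y → y ≤ᵣ z → x ≤ᵣ z
  ≤-trans x≤y y≤z z<x = x≤y (≤-<-trans y≤z z<x)

  ≤-antisym : ∀ {x y} → x ≤ᵣ y → y ≤ᵣ x → x ≡ y
  ≤-antisym x≤y y≤x with ≤⇒<⊎≡ x≤y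
  ... | inj₁ x<y = ⊥-elim (y≤x x<y)
  ... | inj₂ x≡y = x≡y

  x<y⇒0<y-x : ∀ {x y} → x <ᵣ y → 0r <ᵣ y +ᵣ - x
  x<y⇒0<y-x {x} x<y = subst (_<ᵣ _) (-‿inverseʳ x) (+-mono-< (- x) x<y)

  0<y-x⇒x<y : ∀ {x y} → 0r <ᵣ y +ᵣ - x → x <ᵣ y
  0<y-x⇒x<y {x} {y} p = subst₂ _<ᵣ_ (+-idˡ x)
    (solve 2 (λ x y → (y :+ :- x) :+ x := y) refl x y) (+-mono-< x p)

  +-pos : ∀ {x y} → 0r <ᵣ x → 0r <ᵣ y → 0r <ᵣ x +ᵣ y
  +-pos {x} {y} p q = <-trans q (subst (_<ᵣ x +ᵣ y) (+-idˡ y) (+-mono-< y p))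

  +-nonneg : ∀ {x y} → 0r ≤ᵣ x → 0r ≤ᵣ y → 0r ≤ᵣ x +ᵣ y
  +-nonneg {x} {y} p q with ≤⇒<⊎≡ p
  ... | inj₂ refl = subst (0r ≤ᵣ_) (sym (+-idˡ y)) q
  ... | inj₁ 0<x with ≤⇒<⊎≡ q
  ...   | inj₂ refl = subst (0r ≤ᵣ_) (sym (+-identityʳ x)) p
  ...   | inj₁ 0<y = <⇒≤ (+-pos 0<x 0<y)

  *-nonneg : ∀ {x y} → 0r ≤ᵣ x → 0r ≤ᵣ y → 0r ≤ᵣ x *ᵣ y
  *-nonneg {x} {y} p q with ≤⇒<⊎≡ p
  ... | inj₂ refl = ≤-reflexive (sym (zeroˡ y))
  ... | inj₁ 0<x with ≤⇒<⊎≡ q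
  ...   | inj₂ refl = ≤-reflexive (sym (zeroʳ x))
  ...   | inj₁ 0<y = <⇒≤ (*-pos 0<x 0<y)

  x≤y⇒0≤y-x : ∀ {x y} → x ≤ᵣ y → 0r ≤ᵣ y +ᵣ - x
  x≤y⇒0≤y-x {x} {y} x≤y p = x≤y (0<y-x⇒x<y (subst (0r <ᵣ_)
    (solve 2 (λ x y → :- (y :+ :- x) := x :+ :- y) refl x y)
    (subst (0r <ᵣ_) (+-idˡ _) (x<y⇒0<y-x p))))

  0≤y-x⇒x≤y : ∀ {x y} → 0r ≤ᵣ y +ᵣ - x → x ≤ᵣ y
  0≤y-x⇒x≤y {x} {y} p y<x = p (0<y-x⇒x<y (subst (0r <ᵣ_)
    (solve 2 (λ x y → x :+ :- y := con (+ 0) :+ :- (y :+ :- x)) refl x y)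
    (x<y⇒0<y-x y<x)))

  x<0⇒0<-x : ∀ {x} → x <ᵣ 0r → 0r <ᵣ - x
  x<0⇒0<-x {x} p = subst (0r <ᵣ_) (+-idˡ _) (x<y⇒0<y-x p)

  0<-x⇒x<0 : ∀ {x} → 0r <ᵣ - x → x <ᵣ 0r
  0<-x⇒x<0 {x} p = 0<y-x⇒x<y (subst (0r <ᵣ_) (sym (+-idˡ _)) p)

  square-nonneg : ∀ x → 0r ≤ᵣ x *ᵣ x
  square-nonneg x with <-tri 0r x
  ... | inj₁ 0<x = <⇒≤ (*-pos 0<x 0<x)
  ... | inj₂ (inj₁ refl) = ≤-reflexive (sym (zeroˡ _))
  ... | inj₂ (inj₂ x<0) = <⇒≤ (subst (0r <ᵣ_)
    (solve 1 (λ x → :- x :* :- x := x :* x) refl x)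
    (*-pos (x<0⇒0<-x x<0) (x<0⇒0<-x x<0)))

  0<1 : 0r <ᵣ 1r
  0<1 with ≤⇒<⊎≡ (subst (0r ≤ᵣ_) (*-idˡ 1r) (square-nonneg 1r))
  ... | inj₁ p = p
  ... | inj₂ p = ⊥-elim (0≢1 p)

  pos⇒≢0 : ∀ {x} → 0r <ᵣ x → x ≢ 0r
  pos⇒≢0 p refl = <-irrefl _ p

  inv-pos : ∀ {x} (p : 0r <ᵣ x) → 0r <ᵣ inv x (pos⇒≢0 p)
  inv-pos {x} p with <-tri 0r (inv x (pos⇒≢0 p))
  ... | inj₁ q = q
  ... | inj₂ (inj₁ q) = ⊥-elim (0≢1 (trans (trans (sym (zeroˡ x)) (cong (_*ᵣ x) q)) (inv-invˡ x _)))
  ... | inj₂ (inj₂ q) = ⊥-elim (<-irrefl _ (<-trans 0<1 (0<-x⇒x<0 (subst (0r <ᵣ_)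
    (trans (solve 2 (λ i x → :- i :* x := :- (i :* x)) refl _ x) (cong -_ (inv-invˡ x _)))
    (*-pos (x<0⇒0<-x q) p)))))

  *-zero⇒ : ∀ {x y} → x *ᵣ y ≡ 0r → x ≢ 0r → y ≡ 0r
  *-zero⇒ {x} {y} p x≢0 = begin
    y                        ≡⟨ sym (*-idˡ y) ⟩
    1r *ᵣ y                  ≡⟨ cong (_*ᵣ y) (sym (inv-invˡ x x≢0)) ⟩
    inv x x≢0 *ᵣ x *ᵣ y      ≡⟨ *-assoc _ x y ⟩
    inv x x≢0 *ᵣ (x *ᵣ y)    ≡⟨ cong (inv x x≢0 *ᵣ_) p ⟩
    inv x x≢0 *ᵣ 0r          ≡⟨ zeroʳ _ ⟩
    0r                       ∎
    where open ≡-Reasoning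

-- Inner products, orthogonal projection and norm identities.

module Geometry (F : RealField) where
  open RealProperties F
  open Solver using (solve; _:=_; _:+_; _:*_; :-_; con)
  open ≡-Reasoning

  Σ-cong : ∀ m {f f′ : Fin m → ℝ} → (∀ j → f j ≡ f′ j) → Σ[ m ] f ≡ Σ[ m ] f′
  Σ-cong zero e = refl
  Σ-cong (suc m) e = cong₂ _+ᵣ_ (e zero) (Σ-cong m (λ j → e (suc j)))

  Σ-zero : ∀ m {f : Fin m → ℝ} → (∀ j → f j ≡ 0r) → Σ[ m ] f ≡ 0r
  Σ-zero zero e = refl
  Σ-zero (suc m) e = trans (cong₂ _+ᵣ_ (e zero) (Σ-zero m (λ j → e (suc j)))) (+-idˡ 0r)

  Σ-+ : ∀ m (f f′ : Fin m → ℝ) → Σ[ m ] (λ j → f j +ᵣ f′ j) ≡ Σ[ m ] f +ᵣ Σ[ m ] f′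
  Σ-+ zero f f′ = sym (+-idˡ 0r)
  Σ-+ (suc m) f f′ = trans (cong (f zero +ᵣ f′ zero +ᵣ_) (Σ-+ m (λ j → f (suc j)) (λ j → f′ (suc j))))
    (solve 4 (λ a b c d → (a :+ b) :+ (c :+ d) := (a :+ c) :+ (b :+ d)) refl _ _ _ _)

  Σ-*ˡ : ∀ m a (f : Fin m → ℝ) → Σ[ m ] (λ j → a *ᵣ f j) ≡ a *ᵣ Σ[ m ] f
  Σ-*ˡ zero a f = sym (zeroʳ a)
  Σ-*ˡ (suc m) a f = trans (cong (a *ᵣ f zero +ᵣ_) (Σ-*ˡ m a (λ j → f (suc j)))) (sym (distribˡ a _ _))

  Σ-*ʳ : ∀ m a (f : Fin m → ℝ) → Σ[ m ] (λ j → f j *ᵣ a) ≡ Σ[ m ] f *ᵣ a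
  Σ-*ʳ m a f = trans (Σ-cong m (λ j → *-comm (f j) a)) (trans (Σ-*ˡ m a f) (*-comm a _))

  Σ-swap : ∀ m n (f : Fin m → Fin n → ℝ) →
    Σ[ m ] (λ i → Σ[ n ] (f i)) ≡ Σ[ n ] (λ j → Σ[ m ] (λ i → f i j))
  Σ-swap zero n f = sym (Σ-zero n (λ _ → refl))
  Σ-swap (suc m) n f = trans (cong (Σ[ n ] (f zero) +ᵣ_) (Σ-swap m n (λ i → f (suc i))))
    (sym (Σ-+ n (f zero) (λ j → Σ[ m ] (λ i → f (suc i) j))))

  Σ-nonneg : ∀ m {f : Fin m → ℝ} → (∀ j → 0r ≤ᵣ f j) → 0r ≤ᵣ Σ[ m ] f
  Σ-nonneg zero p = <-irrefl 0r
  Σ-nonneg (suc m) p = +-nonneg (p zero) (Σ-nonneg m (λ j → p (suc j)))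

  nonneg-+-≡0 : ∀ {x y} → 0r ≤ᵣ x → 0r ≤ᵣ y → x +ᵣ y ≡ 0r → x ≡ 0r × y ≡ 0r
  nonneg-+-≡0 {x} {y} p q e = x≡0 , trans (sym (+-idˡ y)) (trans (cong (_+ᵣ y) (sym x≡0)) e)
    where
    x≡0 : x ≡ 0r
    x≡0 = ≤-antisym (0≤y-x⇒x≤y (subst (0r ≤ᵣ_)
      (trans (solve 2 (λ x y → y := (x :+ y) :+ :- x) refl x y) (cong (_+ᵣ - x) e)) q)) p

  Σ-nonneg-≡0 : ∀ m {f : Fin m → ℝ} → (∀ j → 0r ≤ᵣ f j) → Σ[ m ] f ≡ 0r → ∀ j → f j ≡ 0r
  Σ-nonneg-≡0 (suc m) p e zero = proj₁ (nonneg-+-≡0 (p zero) (Σ-nonneg m (λ j → p (suc j))) e)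
  Σ-nonneg-≡0 (suc m) p e (suc j) = Σ-nonneg-≡0 m (λ j → p (suc j))
    (proj₂ (nonneg-+-≡0 (p zero) (Σ-nonneg m (λ j → p (suc j))) e)) j

  infixl 6 _+[_]_ _−_
  _+[_]_ : ∀ {d} → Pt d → ℝ → Pt d → Pt d
  (x +[ t ] y) j = x j +ᵣ t *ᵣ y j

  _−_ : ∀ {d} → Pt d → Pt d → Pt d
  x − y = x +[ - 1r ] y

  ∥_∥² : ∀ {d} → Pt d → ℝ
  ∥ x ∥² = ⟨ x , x ⟩

  module _ {d : ℕ} where

    ⟨⟩-comm : (x y : Pt d) → ⟨ x , y ⟩ ≡ ⟨ y , x ⟩
    ⟨⟩-comm x y = Σ-cong d (λ j → *-comm (x j) (y j))

    ⟨⟩-congˡ : {x x′ : Pt d} (z : Pt d) → (∀ j → x j ≡ x′ j) → ⟨ x , z ⟩ ≡ ⟨ x′ , z ⟩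
    ⟨⟩-congˡ z e = Σ-cong d (λ j → cong (_*ᵣ z j) (e j))

    ⟨⟩-congʳ : (z : Pt d) {x x′ : Pt d} → (∀ j → x j ≡ x′ j) → ⟨ z , x ⟩ ≡ ⟨ z , x′ ⟩
    ⟨⟩-congʳ z e = Σ-cong d (λ j → cong (z j *ᵣ_) (e j))

    ⟨⟩-linearˡ : (x : Pt d) (t : ℝ) (y z : Pt d) → ⟨ x +[ t ] y , z ⟩ ≡ ⟨ x , z ⟩ +ᵣ t *ᵣ ⟨ y , z ⟩
    ⟨⟩-linearˡ x t y z = begin
      Σ[ d ] (λ j → (x j +ᵣ t *ᵣ y j) *ᵣ z j)
        ≡⟨ Σ-cong d (λ j → solve 4 (λ a b t c → (a :+ t :* b) :* c := a :* c :+ t :* (b :* c))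
             refl (x j) (y j) t (z j)) ⟩
      Σ[ d ] (λ j → x j *ᵣ z j +ᵣ t *ᵣ (y j *ᵣ z j))
        ≡⟨ Σ-+ d _ _ ⟩
      ⟨ x , z ⟩ +ᵣ Σ[ d ] (λ j → t *ᵣ (y j *ᵣ z j))
        ≡⟨ cong (⟨ x , z ⟩ +ᵣ_) (Σ-*ˡ d t _) ⟩
      ⟨ x , z ⟩ +ᵣ t *ᵣ ⟨ y , z ⟩ ∎

    ⟨⟩-linearʳ : (z x : Pt d) (t : ℝ) (y : Pt d) → ⟨ z , x +[ t ] y ⟩ ≡ ⟨ z , x ⟩ +ᵣ t *ᵣ ⟨ z , y ⟩
    ⟨⟩-linearʳ z x t y = trans (⟨⟩-comm z _) (trans (⟨⟩-linearˡ x t y z)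
      (cong₂ (λ a b → a +ᵣ t *ᵣ b) (⟨⟩-comm x z) (⟨⟩-comm y z)))

    ⟨⟩-zeroˡ : (x : Pt d) → ⟨ (λ _ → 0r) , x ⟩ ≡ 0r
    ⟨⟩-zeroˡ x = Σ-zero d (λ j → zeroˡ _)

    ∥∥²-nonneg : (x : Pt d) → 0r ≤ᵣ ∥ x ∥²
    ∥∥²-nonneg x = Σ-nonneg d (λ j → square-nonneg (x j))

    ∥∥²≡0⇒≡0 : (x : Pt d) → ∥ x ∥² ≡ 0r → ∀ j → x j ≡ 0r
    ∥∥²≡0⇒≡0 x e j with x j ≟ᵣ 0r
    ... | yes p = p
    ... | no p = *-zero⇒ (Σ-nonneg-≡0 d (λ j → square-nonneg (x j)) e j) p

    x−y≡0⇒x≡y : (x y : Pt d) → (∀ j → (x − y) j ≡ 0r) → ∀ j → x j ≡ y j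
    x−y≡0⇒x≡y x y e j = begin
      x j                       ≡⟨ solve 2 (λ x y → x := (x :+ :- con (+ 1) :* y) :+ y) refl (x j) (y j) ⟩
      (x − y) j +ᵣ y j          ≡⟨ cong (_+ᵣ y j) (e j) ⟩
      0r +ᵣ y j                 ≡⟨ +-idˡ (y j) ⟩
      y j                       ∎

    Orthogonal : {I : Set} (v : I → Pt d) → List I → Pt d → Set
    Orthogonal v E z = All (λ i → ⟨ z , v i ⟩ ≡ 0r) E

    Orthogonal-+ : {I : Set} {v : I → Pt d} {E : List I} {x y : Pt d} (t : ℝ) →
      Orthogonal v E x → Orthogonal v E y → Orthogonal v E (x +[ t ] y)
    Orthogonal-+ t [] [] = []
    Orthogonal-+ {v = v} {i ∷ _} {x} {y} t (p ∷ ps) (q ∷ qs) =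
      trans (⟨⟩-linearˡ x t y (v i))
        (trans (cong₂ (λ a b → a +ᵣ t *ᵣ b) p q) (solve 1 (λ t → con (+ 0) :+ t :* con (+ 0) := con (+ 0)) refl t))
      ∷ Orthogonal-+ t ps qs

    opaque
      -- The span of the vectors is replaced by its double orthogonal complement,
      -- so no coefficients appear.
      orthogonal-decomposition : {I : Set} (v : I → Pt d) (E : List I) (w : Pt d) →
        ∃ λ s → Orthogonal v E (w − s) × (∀ z → Orthogonal v E z → ⟨ z , s ⟩ ≡ 0r)
      orthogonal-decomposition v [] w =
        (λ _ → 0r) , [] , λ z _ → trans (⟨⟩-comm z _) (⟨⟩-zeroˡ z)
      orthogonal-decomposition v (i ∷ E) w
        with orthogonal-decomposition v E w | orthogonal-decomposition v E (v i)
      ... | s , w−s⊥E , s∈E⊥⊥ | r , e⊥E , r∈E⊥⊥ = split (∥ e ∥² ≟ᵣ 0r)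
        where
        -- One Gram-Schmidt step: `e` is the part of `v i` orthogonal to the earlier vectors. On
        -- vectors orthogonal to `E`, pairing with `e` and pairing with `v i` agree; if `e`
        -- vanishes, the old `s` therefore still works.
        e : Pt d
        e = v i − r

        ⟨z,v⟩≡⟨z,e⟩ : ∀ z → Orthogonal v E z → ⟨ z , v i ⟩ ≡ ⟨ z , e ⟩
        ⟨z,v⟩≡⟨z,e⟩ z z⊥E = sym (trans (⟨⟩-linearʳ z (v i) (- 1r) r)
          (trans (cong (λ a → ⟨ z , v i ⟩ +ᵣ - 1r *ᵣ a) (r∈E⊥⊥ z z⊥E))
            (solve 1 (λ a → a :+ :- con (+ 1) :* con (+ 0) := a) refl _)))

        split : Dec (∥ e ∥² ≡ 0r) →
          ∃ λ s′ → Orthogonal v (i ∷ E) (w − s′) × (∀ z → Orthogonal v (i ∷ E) z → ⟨ z , s′ ⟩ ≡ 0r)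
        split (yes e≡0) = s
          , (trans (⟨z,v⟩≡⟨z,e⟩ (w − s) w−s⊥E) (trans (⟨⟩-comm _ e)
              (trans (⟨⟩-congˡ (w − s) (∥∥²≡0⇒≡0 e e≡0)) (⟨⟩-zeroˡ (w − s)))) ∷ w−s⊥E)
          , λ { z (_ ∷ z⊥E) → s∈E⊥⊥ z z⊥E }
        split (no e≢0) = s +[ τ ] e
          , (trans (⟨z,v⟩≡⟨z,e⟩ _ w−s′⊥E) (trans (⟨⟩-congˡ e regroup) (trans (⟨⟩-linearˡ (w − s) (- τ) e e) residue))
              ∷ w−s′⊥E)
          , λ { z (z⊥i ∷ z⊥E) → trans (⟨⟩-linearʳ z s τ e)
              (trans (cong₂ (λ a b → a +ᵣ τ *ᵣ b) (s∈E⊥⊥ z z⊥E) (trans (sym (⟨z,v⟩≡⟨z,e⟩ z z⊥E)) z⊥i))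
                (solve 1 (λ t → con (+ 0) :+ t :* con (+ 0) := con (+ 0)) refl τ)) }
          where
          τ : ℝ
          -- The coefficient of the projection of `w − s` onto `e`.
          τ = ⟨ w − s , e ⟩ *ᵣ inv ∥ e ∥² e≢0

          regroup : ∀ j → (w − (s +[ τ ] e)) j ≡ ((w − s) +[ - τ ] e) j
          regroup j = solve 4 (λ w s t e →
            w :+ :- con (+ 1) :* (s :+ t :* e) := w :+ :- con (+ 1) :* s :+ :- t :* e)
            refl (w j) (s j) τ (e j)

          w−s′⊥E : Orthogonal v E (w − (s +[ τ ] e))
          w−s′⊥E = All.map (trans (⟨⟩-congˡ _ regroup)) (Orthogonal-+ (- τ) w−s⊥E e⊥E)

          residue : ⟨ w − s , e ⟩ +ᵣ - τ *ᵣ ∥ e ∥² ≡ 0r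
          residue = begin
            a +ᵣ - (a *ᵣ ν) *ᵣ ∥ e ∥²   ≡⟨ solve 3 (λ a i n → a :+ :- (a :* i) :* n := a :+ :- (a :* (i :* n)))
                  refl a ν ∥ e ∥² ⟩
            a +ᵣ - (a *ᵣ (ν *ᵣ ∥ e ∥²)) ≡⟨ cong (λ u → a +ᵣ - (a *ᵣ u)) (inv-invˡ _ e≢0) ⟩
            a +ᵣ - (a *ᵣ 1r)            ≡⟨ solve 1 (λ a → a :+ :- (a :* con (+ 1)) := con (+ 0)) refl a ⟩
            0r                          ∎
            where
            a ν : ℝ
            a = ⟨ w − s , e ⟩
            ν = inv ∥ e ∥² e≢0

    norm-+ : (x w : Pt d) (t : ℝ) →
      ∥ x +[ t ] w ∥² ≡ ∥ x ∥² +ᵣ (t +ᵣ t) *ᵣ ⟨ x , w ⟩ +ᵣ t *ᵣ t *ᵣ ∥ w ∥²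
    norm-+ x w t = begin
      ⟨ x +[ t ] w , x +[ t ] w ⟩
        ≡⟨ ⟨⟩-linearˡ x t w _ ⟩
      ⟨ x , x +[ t ] w ⟩ +ᵣ t *ᵣ ⟨ w , x +[ t ] w ⟩
        ≡⟨ cong₂ (λ a b → a +ᵣ t *ᵣ b) (⟨⟩-linearʳ x x t w) (⟨⟩-linearʳ w x t w) ⟩
      (∥ x ∥² +ᵣ t *ᵣ ⟨ x , w ⟩) +ᵣ t *ᵣ (⟨ w , x ⟩ +ᵣ t *ᵣ ∥ w ∥²)
        ≡⟨ cong (λ a → (∥ x ∥² +ᵣ t *ᵣ ⟨ x , w ⟩) +ᵣ t *ᵣ (a +ᵣ t *ᵣ ∥ w ∥²)) (⟨⟩-comm w x) ⟩
      (∥ x ∥² +ᵣ t *ᵣ ⟨ x , w ⟩) +ᵣ t *ᵣ (⟨ x , w ⟩ +ᵣ t *ᵣ ∥ w ∥²)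
        ≡⟨ solve 4 (λ n p m t → (n :+ t :* p) :+ t :* (p :+ t :* m) := n :+ (t :+ t) :* p :+ t :* t :* m)
             refl ∥ x ∥² ⟨ x , w ⟩ ∥ w ∥² t ⟩
      ∥ x ∥² +ᵣ (t +ᵣ t) *ᵣ ⟨ x , w ⟩ +ᵣ t *ᵣ t *ᵣ ∥ w ∥² ∎

    x+[y−x]≡y : (x y : Pt d) → ∀ j → (x +[ 1r ] (y − x)) j ≡ y j
    x+[y−x]≡y x y j = solve 2 (λ x y → x :+ con (+ 1) :* (y :+ :- con (+ 1) :* x) := y) refl (x j) (y j)

    norm-cong : {x y : Pt d} → (∀ j → x j ≡ y j) → ∥ x ∥² ≡ ∥ y ∥²
    norm-cong {x} {y} e = trans (⟨⟩-congˡ x e) (⟨⟩-congʳ y e)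

    norm-difference : (x y : Pt d) →
      ∥ y ∥² ≡ ∥ x ∥² +ᵣ (1r +ᵣ 1r) *ᵣ ⟨ x , y − x ⟩ +ᵣ ∥ y − x ∥²
    norm-difference x y = trans (sym (norm-cong (x+[y−x]≡y x y))) (trans (norm-+ x (y − x) 1r)
      (solve 3 (λ n p m → n :+ (con (+ 1) :+ con (+ 1)) :* p :+ con (+ 1) :* con (+ 1) :* m
                       := n :+ (con (+ 1) :+ con (+ 1)) :* p :+ m) refl _ _ _))

    -- Convexity of the squared norm as an identity: the gap is t(∥x∥² - ∥y∥²) + t(1 - t)∥y - x∥²,
    -- and both terms are nonnegative.
    norm-convex : (x y : Pt d) {t : ℝ} → 0r ≤ᵣ t → t ≤ᵣ 1r → ∥ y ∥² ≤ᵣ ∥ x ∥² →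
      ∥ x +[ t ] (y − x) ∥² ≤ᵣ ∥ x ∥²
    norm-convex x y {t} 0≤t t≤1 y≤x = 0≤y-x⇒x≤y (subst (0r ≤ᵣ_) (sym gap)
      (+-nonneg (*-nonneg 0≤t (x≤y⇒0≤y-x y≤x))
        (*-nonneg (*-nonneg 0≤t (x≤y⇒0≤y-x t≤1)) (∥∥²-nonneg (y − x)))))
      where
      gap : ∥ x ∥² +ᵣ - ∥ x +[ t ] (y − x) ∥² ≡
            t *ᵣ (∥ x ∥² +ᵣ - ∥ y ∥²) +ᵣ t *ᵣ (1r +ᵣ - t) *ᵣ ∥ y − x ∥²
      gap = trans
        (cong (λ a → n +ᵣ - a) (norm-+ x (y − x) t))
        (trans
          (solve 4 (λ n p m t →
            n :+ :- (n :+ (t :+ t) :* p :+ t :* t :* m) :=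
            t :* (n :+ :- (n :+ (con (+ 1) :+ con (+ 1)) :* p :+ m)) :+ t :* (con (+ 1) :+ :- t) :* m)
            refl n ⟨ x , y − x ⟩ m t)
          (cong (λ b → t *ᵣ (n +ᵣ - b) +ᵣ t *ᵣ (1r +ᵣ - t) *ᵣ m) (sym (norm-difference x y))))
        where
        n = ∥ x ∥²
        m = ∥ y − x ∥²

-- The point of a polyhedron closest to the origin.

module Closest (F : RealField) where
  open RealProperties F
  open Geometry F
  open Solver using (solve; _:=_; _:+_; _:*_; :-_; con)
  open ≡-Reasoning

  opaque
    zero-crossing : ∀ {a b} → a ≤ᵣ 0r → 0r <ᵣ b →
      ∃ λ t → 0r ≤ᵣ t × t ≤ᵣ 1r × a +ᵣ t *ᵣ (b +ᵣ - a) ≡ 0r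
    zero-crossing {a} {b} a≤0 0<b = t , 0≤t , 0≤y-x⇒x≤y (subst (0r ≤ᵣ_) (sym 1-t) 0≤1-t) , crossing
      where
      0<b-a : 0r <ᵣ b +ᵣ - a
      0<b-a = x<y⇒0<y-x (≤-<-trans a≤0 0<b)
      ν t : ℝ
      ν = inv (b +ᵣ - a) (pos⇒≢0 0<b-a)
      -- The root -a/(b - a) of the linear interpolation from `a` to `b`; its complement 1 - t is
      -- b/(b - a).
      t = - a *ᵣ ν
      0≤-a : 0r ≤ᵣ - a
      0≤-a = subst (0r ≤ᵣ_) (+-idˡ _) (x≤y⇒0≤y-x a≤0)
      0≤t : 0r ≤ᵣ t
      0≤t = *-nonneg 0≤-a (<⇒≤ (inv-pos 0<b-a))
      0≤1-t : 0r ≤ᵣ b *ᵣ ν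
      0≤1-t = *-nonneg (<⇒≤ 0<b) (<⇒≤ (inv-pos 0<b-a))
      1-t : 1r +ᵣ - t ≡ b *ᵣ ν
      1-t = trans (cong (λ u → u +ᵣ - t) (sym (inv-invˡ _ (pos⇒≢0 0<b-a))))
        (solve 3 (λ a b i → i :* (b :+ :- a) :+ :- (:- a :* i) := b :* i) refl a b ν)
      crossing : a +ᵣ t *ᵣ (b +ᵣ - a) ≡ 0r
      crossing = trans (solve 3 (λ a b i → a :+ (:- a :* i) :* (b :+ :- a) := a :+ :- a :* (i :* (b :+ :- a)))
            refl a b ν)
        (trans (cong (λ u → a +ᵣ - a *ᵣ u) (inv-invˡ _ (pos⇒≢0 0<b-a)))
          (solve 1 (λ a → a :+ :- a :* con (+ 1) := con (+ 0)) refl a))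

  convex-nonpos : ∀ {a b t} → 0r ≤ᵣ t → t ≤ᵣ 1r → a ≤ᵣ 0r → b ≤ᵣ 0r → a +ᵣ t *ᵣ (b +ᵣ - a) ≤ᵣ 0r
  convex-nonpos {a} {b} {t} 0≤t t≤1 a≤0 b≤0 = 0≤y-x⇒x≤y (subst (0r ≤ᵣ_)
    (solve 3 (λ a b t → (con (+ 1) :+ :- t) :* (con (+ 0) :+ :- a) :+ t :* (con (+ 0) :+ :- b)
                     := con (+ 0) :+ :- (a :+ t :* (b :+ :- a))) refl a b t)
    (+-nonneg (*-nonneg (x≤y⇒0≤y-x t≤1) (x≤y⇒0≤y-x a≤0)) (*-nonneg 0≤t (x≤y⇒0≤y-x b≤0))))

  module _ {n d : ℕ} (g : Fin n → Pt d) (c : Fin n → ℝ) where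

    h-+ : ∀ i x t u → h g c i (x +[ t ] u) ≡ h g c i x +ᵣ t *ᵣ ⟨ u , g i ⟩
    h-+ i x t u = trans (cong (_+ᵣ c i) (⟨⟩-linearˡ x t u (g i)))
      (solve 3 (λ a b e → (a :+ b) :+ e := a :+ e :+ b) refl ⟨ x , g i ⟩ (t *ᵣ ⟨ u , g i ⟩) (c i))

    h-difference : ∀ i x y → ⟨ y − x , g i ⟩ ≡ h g c i y +ᵣ - h g c i x
    h-difference i x y = trans (⟨⟩-linearˡ y (- 1r) x (g i))
      (solve 3 (λ a b e → a :+ :- con (+ 1) :* b := (a :+ e) :+ :- (b :+ e)) refl ⟨ y , g i ⟩ ⟨ x , g i ⟩ (c i))

    h-segment : ∀ i x y t →
      h g c i (x +[ t ] (y − x)) ≡ h g c i x +ᵣ t *ᵣ (h g c i y +ᵣ - h g c i x)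
    h-segment i x y t = trans (h-+ i x t (y − x)) (cong (λ a → h g c i x +ᵣ t *ᵣ a) (h-difference i x y))

    Inequalities Equations : List (Fin n) → Pt d → Set
    Inequalities L x = All (λ i → h g c i x ≤ᵣ 0r) L
    Equations E x = All (λ i → h g c i x ≡ 0r) E

    -- Equations are kept next to the inequalities because the induction on `L` turns violated
    -- inequalities into equations.
    Closest : List (Fin n) → List (Fin n) → Pt d → Set
    Closest L E y = Inequalities L y × Equations E y ×
      (∀ z → Inequalities L z → Equations E z → ∥ y ∥² ≤ᵣ ∥ z ∥²)

    segment-Inequalities : ∀ {L x y t} → 0r ≤ᵣ t → t ≤ᵣ 1r →
      Inequalities L x → Inequalities L y → Inequalities L (x +[ t ] (y − x))
    segment-Inequalities 0≤t t≤1 [] [] = []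
    segment-Inequalities {i ∷ _} {x} {y} {t} 0≤t t≤1 (p ∷ ps) (q ∷ qs) =
      subst (_≤ᵣ 0r) (sym (h-segment i x y t)) (convex-nonpos 0≤t t≤1 p q)
      ∷ segment-Inequalities 0≤t t≤1 ps qs

    segment-Equations : ∀ {E x y} t → Equations E x → Equations E y → Equations E (x +[ t ] (y − x))
    segment-Equations t [] [] = []
    segment-Equations {i ∷ _} {x} {y} t (p ∷ ps) (q ∷ qs) =
      trans (h-segment i x y t) (trans (cong₂ (λ a b → a +ᵣ t *ᵣ (b +ᵣ - a)) p q)
        (solve 1 (λ t → con (+ 0) :+ t :* (con (+ 0) :+ :- con (+ 0)) := con (+ 0)) refl t))
      ∷ segment-Equations t ps qs

    Equations-difference : ∀ {E x y} → Equations E x → Equations E y → Orthogonal g E (y − x)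
    Equations-difference [] [] = []
    Equations-difference {i ∷ _} {x} {y} (p ∷ ps) (q ∷ qs) =
      trans (h-difference i x y) (trans (cong₂ (λ a b → b +ᵣ - a) p q) (-‿inverseʳ 0r))
      ∷ Equations-difference ps qs

    Equations-+ : ∀ {E x u} t → Equations E x → Orthogonal g E u → Equations E (x +[ t ] u)
    Equations-+ t [] [] = []
    Equations-+ {i ∷ _} {x} {u} t (p ∷ ps) (q ∷ qs) =
      trans (h-+ i x t u) (trans (cong₂ (λ a b → a +ᵣ t *ᵣ b) p q)
        (solve 1 (λ t → con (+ 0) :+ t :* con (+ 0) := con (+ 0)) refl t))
      ∷ Equations-+ t ps qs

    h-cong : ∀ i {x y} → (∀ j → x j ≡ y j) → h g c i x ≡ h g c i y
    h-cong i e = cong (_+ᵣ c i) (⟨⟩-congˡ (g i) e)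

    opaque
      -- The projection `s` of any solution onto the span of the normals is again a solution, since
      -- `x − s` is orthogonal to all normals. It is orthogonal to every difference of solutions, so
      -- Pythagoras gives ∥z∥² - ∥s∥² = ∥z - s∥².
      closest-in-flat : ∀ E {x} → Equations E x → ∃ (Closest [] E)
      closest-in-flat E {x} x∈E with orthogonal-decomposition g E x
      ... | s , x−s⊥E , s∈E⊥⊥ = s , [] , s∈E , closer
        where
        s≡x−[x−s] : ∀ j → s j ≡ (x − (x − s)) j
        s≡x−[x−s] j = solve 2 (λ x s → s := x :+ :- con (+ 1) :* (x :+ :- con (+ 1) :* s)) refl (x j) (s j)

        s∈E : Equations E s
        s∈E = All.map (λ {i} e → trans (h-cong i s≡x−[x−s]) e) (Equations-+ (- 1r) x∈E x−s⊥E)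

        closer : ∀ z → Inequalities [] z → Equations E z → ∥ s ∥² ≤ᵣ ∥ z ∥²
        closer z _ z∈E = 0≤y-x⇒x≤y (subst (0r ≤ᵣ_) (sym gap) (∥∥²-nonneg (z − s)))
          where
          gap : ∥ z ∥² +ᵣ - ∥ s ∥² ≡ ∥ z − s ∥²
          gap = begin
            ∥ z ∥² +ᵣ - ∥ s ∥²
              ≡⟨ cong (_+ᵣ - ∥ s ∥²) (norm-difference s z) ⟩
            ∥ s ∥² +ᵣ (1r +ᵣ 1r) *ᵣ ⟨ s , z − s ⟩ +ᵣ ∥ z − s ∥² +ᵣ - ∥ s ∥²
              ≡⟨ cong (λ p → ∥ s ∥² +ᵣ (1r +ᵣ 1r) *ᵣ p +ᵣ ∥ z − s ∥² +ᵣ - ∥ s ∥²)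
                   (trans (⟨⟩-comm s (z − s)) (s∈E⊥⊥ (z − s) (Equations-difference s∈E z∈E))) ⟩
            ∥ s ∥² +ᵣ (1r +ᵣ 1r) *ᵣ 0r +ᵣ ∥ z − s ∥² +ᵣ - ∥ s ∥²
              ≡⟨ solve 2 (λ a b → a :+ (con (+ 1) :+ con (+ 1)) :* con (+ 0) :+ b :+ :- a := b)
                    refl ∥ s ∥² ∥ z − s ∥² ⟩
            ∥ z − s ∥² ∎

    opaque
      -- Minimality of `y` makes it no farther from the origin than `z`, so by `norm-convex` no
      -- point of the segment from `z` to `y` is farther than `z`; `z′` is where the function `i`
      -- vanishes on it.
      crossing : ∀ {L E i y z} → Closest L E y → 0r <ᵣ h g c i y →
        h g c i z ≤ᵣ 0r → Inequalities L z → Equations E z →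
        ∃ λ z′ → Inequalities L z′ × Equations (i ∷ E) z′ × ∥ z′ ∥² ≤ᵣ ∥ z ∥²
      crossing {i = i} {y} {z} (y∈L , y∈E , y-min) 0<hy hz≤0 z∈L z∈E =
        let t , 0≤t , t≤1 , e = zero-crossing hz≤0 0<hy in
        z +[ t ] (y − z) , segment-Inequalities 0≤t t≤1 z∈L y∈L
        , trans (h-segment i z y t) e ∷ segment-Equations t z∈E y∈E
        , norm-convex z y 0≤t t≤1 (y-min z z∈L z∈E)

    -- If the closest point for the other constraints violates the constraint i, then
    -- segments to it from feasible points cross the hyperplane of i without
    -- getting farther from the origin, so i may be turned into an equation.
    opaque
      closest-on-hyperplane : ∀ {L E i y y′} → Closest L E y → 0r <ᵣ h g c i y →
        Closest L (i ∷ E) y′ → Closest (i ∷ L) E y′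
      closest-on-hyperplane {L} {E} {i} {y} {y′} y-closest 0<hy (y′∈L , hy′≡0 ∷ y′∈E , y′-min) =
        ≤-reflexive hy′≡0 ∷ y′∈L , y′∈E , closer
        where
        closer : ∀ z → Inequalities (i ∷ L) z → Equations E z → ∥ y′ ∥² ≤ᵣ ∥ z ∥²
        closer z (hz≤0 ∷ z∈L) z∈E with crossing {L} {E} {i} {y} {z} y-closest 0<hy hz≤0 z∈L z∈E
        ... | z′ , z′∈L , z′∈iE , z′≤z = ≤-trans (y′-min z′ z′∈L z′∈iE) z′≤z

      -- Either the closest point for `L` already satisfies constraint `i`, or the problem moves to
      -- the hyperplane of `i`. The second case uses the longer list `i ∷ E`, hence an induction
      -- hypothesis for all `E′`; the feasible `x` supplies, through `crossing`, a feasible point on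
      -- that hyperplane.
      add-inequality : ∀ {L E} i {y} → (∀ E′ {x} → Inequalities L x → Equations E′ x → ∃ (Closest L E′)) →
        ∀ {x} → Inequalities (i ∷ L) x → Equations E x → Closest L E y → ∃ (Closest (i ∷ L) E)
      add-inequality {L} {E} i {y} closest-L {x} (hx≤0 ∷ x∈L) x∈E y-closest@(y∈L , y∈E , y-min)
        with 0r <? h g c i y
      ... | no hy≤0 = y , hy≤0 ∷ y∈L , y∈E , λ { z (_ ∷ z∈L) z∈E → y-min z z∈L z∈E }
      ... | yes 0<hy with crossing {L} {E} {i} {y} {x} y-closest 0<hy hx≤0 x∈L x∈E
      ...   | x′ , x′∈L , x′∈iE , _ with closest-L (i ∷ E) x′∈L x′∈iE
      ...     | y′ , y′-closest = y′ , closest-on-hyperplane {L} {E} {i} {y} {y′} y-closest 0<hy y′-closest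

      closest : ∀ L E {x} → Inequalities L x → Equations E x → ∃ (Closest L E)
      closest [] E _ x∈E = closest-in-flat E x∈E
      closest (i ∷ L) E {x} x∈iL@(_ ∷ x∈L) x∈E with closest L E x∈L x∈E
      ... | y , y-closest = add-inequality i (closest L) x∈iL x∈E y-closest

-- Linear dependence and orthogonal complements.

module LinearAlgebra (F : RealField) where
  open RealProperties F
  open Geometry F
  open Solver using (solve; _:=_; _:+_; _:*_; :-_; con)
  open ≡-Reasoning

  module Elimination {N m : ℕ} (w : Fin (suc m) → Pt (suc N)) (l : Fin (suc N)) (pivot≢0 : w zero l ≢ 0r) where

    ratio : Fin m → ℝ
    ratio j = w (suc j) l *ᵣ inv (w zero l) pivot≢0

    eliminated : Fin m → Pt (suc N)
    eliminated j i = w (suc j) i +ᵣ - (ratio j *ᵣ w zero i)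

    eliminated-pivot : ∀ j → eliminated j l ≡ 0r
    eliminated-pivot j = begin
      b +ᵣ - (b *ᵣ ν *ᵣ p)     ≡⟨ solve 3 (λ b i p → b :+ :- (b :* i :* p) := b :+ :- (b :* (i :* p))) refl b ν p ⟩
      b +ᵣ - (b *ᵣ (ν *ᵣ p))   ≡⟨ cong (λ u → b +ᵣ - (b *ᵣ u)) (inv-invˡ p pivot≢0) ⟩
      b +ᵣ - (b *ᵣ 1r)         ≡⟨ solve 1 (λ b → b :+ :- (b :* con (+ 1)) := con (+ 0)) refl b ⟩
      0r                       ∎
      where
      p = w zero l
      b = w (suc j) l
      ν = inv (w zero l) pivot≢0

    -- Carries a combination of the eliminated vectors back to `w`: expanding `eliminated` collects
    -- all subtracted multiples in the coefficient of the pivot vector.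
    coefficients : Pt m → Pt (suc m)
    coefficients a zero = - Σ[ m ] (λ j → a j *ᵣ ratio j)
    coefficients a (suc j) = a j

    combination : ∀ a i →
      Σ[ suc m ] (λ j → coefficients a j *ᵣ w j i) ≡ Σ[ m ] (λ j → a j *ᵣ eliminated j i)
    combination a i = begin
      - S *ᵣ q +ᵣ T
        ≡⟨ solve 3 (λ s q t → :- s :* q :+ t := t :+ :- q :* s) refl S q T ⟩
      T +ᵣ - q *ᵣ S
        ≡⟨ cong (T +ᵣ_) (sym (Σ-*ˡ m (- q) _)) ⟩
      T +ᵣ Σ[ m ] (λ j → - q *ᵣ (a j *ᵣ ratio j))
        ≡⟨ sym (Σ-+ m _ _) ⟩
      Σ[ m ] (λ j → a j *ᵣ w (suc j) i +ᵣ - q *ᵣ (a j *ᵣ ratio j))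
        ≡⟨ Σ-cong m (λ j → solve 4 (λ a b q r → a :* b :+ :- q :* (a :* r) := a :* (b :+ :- (r :* q)))
             refl (a j) (w (suc j) i) q (ratio j)) ⟩
      Σ[ m ] (λ j → a j *ᵣ eliminated j i) ∎
      where
      S T q : ℝ
      S = Σ[ m ] (λ j → a j *ᵣ ratio j)
      T = Σ[ m ] (λ j → a j *ᵣ w (suc j) i)
      q = w zero i

  opaque
    dependent : ∀ {N m} → N ℕ.< m → (w : Fin m → Pt N) →
      ∃ λ (a : Pt m) → (∃ λ j → a j ≢ 0r) × (∀ i → Σ[ m ] (λ j → a j *ᵣ w j i) ≡ 0r)
    dependent {zero} {suc m} _ w = (λ _ → 1r) , (zero , 0≢1 ∘ sym) , λ ()
    dependent {suc N} {suc m} (s≤s N<m) w with Fin.any? (λ l → ¬? (w zero l ≟ᵣ 0r))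
    ... | no w₀≡0 = a , (zero , 0≢1 ∘ sym) , λ i → trans
        (cong₂ _+ᵣ_ (trans (*-idˡ _) (w₀-zero i)) (Σ-zero m (λ j → zeroˡ _))) (+-idˡ 0r)
      where
      a : Pt (suc m)
      a zero = 1r
      a (suc _) = 0r
      w₀-zero : ∀ i → w zero i ≡ 0r
      w₀-zero i with w zero i ≟ᵣ 0r
      ... | yes p = p
      ... | no p = ⊥-elim (w₀≡0 (i , p))
    -- Coordinate `l` of every eliminated vector is zero, so `punchIn l` drops it, leaving one
    -- vector and one coordinate fewer.
    ... | yes (l , pivot≢0) with dependent N<m (λ j i → Elimination.eliminated w l pivot≢0 j (punchIn l i))
    ...   | a , (j , aj≢0) , relation = coefficients a , (suc j , aj≢0) , λ i → trans (combination a i) (vanishes i)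
      where
      open Elimination w l pivot≢0
      vanishes : ∀ i → Σ[ m ] (λ j → a j *ᵣ eliminated j i) ≡ 0r
      vanishes i with l Fin.≟ i
      ... | yes refl = Σ-zero m (λ j → trans (cong (a j *ᵣ_) (eliminated-pivot j)) (zeroʳ (a j)))
      ... | no l≢i = subst (λ i → Σ[ m ] (λ j → a j *ᵣ eliminated j i) ≡ 0r)
        (Fin.punchIn-punchOut l≢i) (relation (punchOut l≢i))

  All-lookup⁻ : {A : Set} {P : A → Set} (xs : List A) → (∀ i → P (List.lookup xs i)) → All P xs
  All-lookup⁻ [] p = []
  All-lookup⁻ (x ∷ xs) p = p zero ∷ All-lookup⁻ xs (p ∘ suc)

  opaque
    -- A linear relation among the `d` columns of the matrix with rows `R` is a vector orthogonal to
    -- every row.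
    kernel : ∀ {d} (R : List (Pt d)) → length R ℕ.< d →
      ∃ λ a → ∥ a ∥² ≢ 0r × Orthogonal id R a
    kernel R R<d with dependent R<d (λ j i → List.lookup R i j)
    ... | a , (j , aj≢0) , relation =
      a , (λ a≡0 → aj≢0 (∥∥²≡0⇒≡0 a a≡0 j)) , All-lookup⁻ R relation

  OrthogonalFamily : ∀ {d r} → (Fin r → Pt d) → Set
  OrthogonalFamily v = ∀ k l → k ≢ l → ⟨ v k , v l ⟩ ≡ 0r

  opaque
    -- Each new kernel vector joins `R`, so the later ones are orthogonal to it as well. Pairwise
    -- orthogonality then certifies the linear independence that `Generic` asks of the directions of
    -- a flat.
    orthogonal-complement : ∀ {d} r (R : List (Pt d)) → length R ℕ.+ r ℕ.≤ d →
      ∃ λ (v : Fin r → Pt d) → (∀ k → ∥ v k ∥² ≢ 0r) × (∀ k → Orthogonal id R (v k)) × OrthogonalFamily v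
    orthogonal-complement zero R _ = (λ ()) , (λ ()) , (λ ()) , λ ()
    orthogonal-complement {d} (suc r) R R+r≤d
      with kernel R (ℕ.≤-trans (ℕ.s≤s (ℕ.m≤m+n (length R) r)) (subst (ℕ._≤ d) (ℕ.+-suc _ r) R+r≤d))
    ... | a , a≢0 , a⊥R with orthogonal-complement r (a ∷ R) (subst (ℕ._≤ d) (ℕ.+-suc _ r) R+r≤d)
    ...   | v , v≢0 , v⊥aR , v⊥v = v′ , v′≢0 , v′⊥R , v′⊥v′
      where
      v′ : Fin (suc r) → Pt d
      v′ zero = a
      v′ (suc k) = v k
      v′≢0 : ∀ k → ∥ v′ k ∥² ≢ 0r
      v′≢0 zero = a≢0
      v′≢0 (suc k) = v≢0 k
      v′⊥R : ∀ k → Orthogonal id R (v′ k)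
      v′⊥R zero = a⊥R
      v′⊥R (suc k) = All.tail (v⊥aR k)
      v′⊥v′ : OrthogonalFamily v′
      v′⊥v′ zero zero 0≢0 = ⊥-elim (0≢0 refl)
      v′⊥v′ zero (suc l) _ = trans (⟨⟩-comm a (v l)) (All.head (v⊥aR l))
      v′⊥v′ (suc k) zero _ = All.head (v⊥aR k)
      v′⊥v′ (suc k) (suc l) k≢l = v⊥v k l (k≢l ∘ cong suc)

  Σ-single : ∀ m {f : Fin m → ℝ} k → (∀ j → j ≢ k → f j ≡ 0r) → Σ[ m ] f ≡ f k
  Σ-single (suc m) {f} zero e =
    trans (cong (f zero +ᵣ_) (Σ-zero m (λ j → e (suc j) λ ()))) (+-identityʳ _)
  Σ-single (suc m) {f} (suc k) e =
    trans (cong₂ _+ᵣ_ (e zero λ ()) (Σ-single m k (λ j j≢k → e (suc j) (j≢k ∘ Fin.suc-injective)))) (+-idˡ _)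

  -- Pairing a relation with `v k` leaves the single term `a k *ᵣ ∥ v k ∥²`.
  orthogonal⇒LinIndep : ∀ {d r} (v : Fin r → Pt d) → (∀ k → ∥ v k ∥² ≢ 0r) → OrthogonalFamily v → LinIndep v
  orthogonal⇒LinIndep {d} {r} v v≢0 v⊥v a relation k = *-zero⇒ (trans (*-comm _ _) (begin
    a k *ᵣ ⟨ v k , v k ⟩
      ≡⟨ sym (Σ-single r k (λ j j≢k → trans (cong (a j *ᵣ_) (v⊥v j k j≢k)) (zeroʳ (a j)))) ⟩
    Σ[ r ] (λ l → a l *ᵣ ⟨ v l , v k ⟩)
      ≡⟨ Σ-cong r (λ l → sym (Σ-*ˡ d (a l) _)) ⟩
    Σ[ r ] (λ l → Σ[ d ] (λ j → a l *ᵣ (v l j *ᵣ v k j)))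
      ≡⟨ Σ-swap r d _ ⟩
    Σ[ d ] (λ j → Σ[ r ] (λ l → a l *ᵣ (v l j *ᵣ v k j)))
      ≡⟨ Σ-cong d (λ j → Σ-cong r (λ l → sym (*-assoc (a l) (v l j) (v k j)))) ⟩
    Σ[ d ] (λ j → Σ[ r ] (λ l → a l *ᵣ v l j *ᵣ v k j))
      ≡⟨ Σ-cong d (λ j → Σ-*ʳ r (v k j) _) ⟩
    Σ[ d ] (λ j → Σ[ r ] (λ l → a l *ᵣ v l j) *ᵣ v k j)
      ≡⟨ Σ-zero d (λ j → trans (cong (_*ᵣ v k j) (relation j)) (zeroˡ (v k j))) ⟩
    0r ∎)) (v≢0 k)

  -- Conditions that hold for all sufficiently small positive parameters.

  Eventually : (ℝ → Set) → Set
  Eventually P = ∃ λ ε → 0r <ᵣ ε × (∀ t → 0r <ᵣ t → t <ᵣ ε → P t)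

  Eventually-map : {P Q : ℝ → Set} → (∀ {t} → 0r <ᵣ t → P t → Q t) → Eventually P → Eventually Q
  Eventually-map f (ε , 0<ε , p) = ε , 0<ε , λ t 0<t t<ε → f 0<t (p t 0<t t<ε)

  Eventually-× : {P Q : ℝ → Set} → Eventually P → Eventually Q → Eventually (λ t → P t × Q t)
  Eventually-× (ε , 0<ε , p) (δ , 0<δ , q) with ε <? δ
  ... | yes ε<δ = ε , 0<ε , λ t 0<t t<ε → p t 0<t t<ε , q t 0<t (<-trans t<ε ε<δ)
  ... | no δ≤ε = δ , 0<δ , λ t 0<t t<δ → p t 0<t (<-≤-trans t<δ δ≤ε) , q t 0<t t<δ

  Eventually-∀ : ∀ n {P : Fin n → ℝ → Set} → (∀ i → Eventually (P i)) → Eventually (λ t → ∀ i → P i t)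
  Eventually-∀ zero p = 1r , 0<1 , λ _ _ _ ()
  Eventually-∀ (suc n) p = Eventually-map (λ { _ (p₀ , ps) zero → p₀ ; _ (p₀ , ps) (suc i) → ps i })
    (Eventually-× (p zero) (Eventually-∀ n (p ∘ suc)))

  0<2 : 0r <ᵣ 1r +ᵣ 1r
  0<2 = +-pos 0<1 0<1

  Eventually-witness : {P : ℝ → Set} → Eventually P → ∃ λ t → 0r <ᵣ t × P t
  Eventually-witness (ε , 0<ε , p) = ε/2 , 0<ε/2 , p ε/2 0<ε/2 (0<y-x⇒x<y (subst (0r <ᵣ_) (sym ε-ε/2) 0<ε/2))
    where
    ½ = inv (1r +ᵣ 1r) (pos⇒≢0 0<2)
    ε/2 = ε *ᵣ ½
    0<ε/2 : 0r <ᵣ ε/2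
    0<ε/2 = *-pos 0<ε (inv-pos 0<2)
    ε-ε/2 : ε +ᵣ - ε/2 ≡ ε/2
    ε-ε/2 = begin
      ε +ᵣ - ε/2                         ≡⟨ cong (_+ᵣ - ε/2) (sym (*-identityʳ ε)) ⟩
      ε *ᵣ 1r +ᵣ - ε/2                   ≡⟨ cong (λ u → ε *ᵣ u +ᵣ - ε/2) (sym (inv-invˡ _ (pos⇒≢0 0<2))) ⟩
      ε *ᵣ (½ *ᵣ (1r +ᵣ 1r)) +ᵣ - ε/2    ≡⟨ solve 2 (λ e h → e :* (h :* (con (+ 1) :+ con (+ 1))) :+ :- (e :* h) := e :* h)
            refl ε ½ ⟩
      ε/2                                ∎

  linear-eventually-pos : ∀ {α} → 0r <ᵣ α → ∀ β → Eventually (λ t → 0r <ᵣ α +ᵣ t *ᵣ β)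
  linear-eventually-pos {α} 0<α β with β <? 0r
  ... | no 0≤β = 1r , 0<1 , λ t 0<t _ → <-≤-trans 0<α (0≤y-x⇒x≤y (subst (0r ≤ᵣ_)
      (solve 2 (λ a b → b := a :+ b :+ :- a) refl α (t *ᵣ β)) (*-nonneg (<⇒≤ 0<t) 0≤β)))
  -- The bound α/(-β) is the zero of the decreasing function α + tβ.
  ... | yes β<0 = α *ᵣ ν , *-pos 0<α (inv-pos 0<-β) , λ t _ t<ε →
      subst (0r <ᵣ_) (scaled t) (*-pos 0<-β (x<y⇒0<y-x t<ε))
    where
    0<-β : 0r <ᵣ - β
    0<-β = x<0⇒0<-x β<0
    ν = inv (- β) (pos⇒≢0 0<-β)
    scaled : ∀ t → - β *ᵣ (α *ᵣ ν +ᵣ - t) ≡ α +ᵣ t *ᵣ β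
    scaled t = begin
      - β *ᵣ (α *ᵣ ν +ᵣ - t)          ≡⟨ solve 4 (λ a b i t → :- b :* (a :* i :+ :- t) := a :* (i :* :- b) :+ t :* b)
            refl α β ν t ⟩
      α *ᵣ (ν *ᵣ - β) +ᵣ t *ᵣ β       ≡⟨ cong (λ u → α *ᵣ u +ᵣ t *ᵣ β) (inv-invˡ _ (pos⇒≢0 0<-β)) ⟩
      α *ᵣ 1r +ᵣ t *ᵣ β               ≡⟨ cong (_+ᵣ t *ᵣ β) (*-identityʳ α) ⟩
      α +ᵣ t *ᵣ β                     ∎

  linear-eventually-neg : ∀ {α} → α <ᵣ 0r → ∀ β → Eventually (λ t → α +ᵣ t *ᵣ β <ᵣ 0r)
  linear-eventually-neg {α} α<0 β = Eventually-map
    (λ {t} _ p → 0<-x⇒x<0 (subst (0r <ᵣ_)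
      (solve 3 (λ a b t → :- a :+ t :* :- b := :- (a :+ t :* b)) refl α β t) p))
    (linear-eventually-pos (x<0⇒0<-x α<0) (- β))

-- Lists without repetition, and hefts of nested sign vectors.

Unique⇒lookup-injective : {A : Set} {xs : List A} → Unique xs → Injective _≡_ _≡_ (List.lookup xs)
Unique⇒lookup-injective {xs = _ ∷ _} _ {zero} {zero} _ = refl
Unique⇒lookup-injective {xs = _ ∷ xs} (x∉xs ∷ _) {zero} {suc j} e = ⊥-elim (All.lookup x∉xs (∈-lookup j) e)
Unique⇒lookup-injective {xs = _ ∷ xs} (x∉xs ∷ _) {suc i} {zero} e = ⊥-elim (All.lookup x∉xs (∈-lookup i) (sym e))
Unique⇒lookup-injective {xs = _ ∷ _} (_ ∷ u) {suc i} {suc j} e = cong suc (Unique⇒lookup-injective u e)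

heft-mono : ∀ {n} (σ τ : Vec Bool n) → (∀ i → lookup τ i ≡ false → lookup σ i ≡ false) → heft σ ℕ.≤ heft τ
heft-mono [] [] σ⊆τ = z≤n
heft-mono (false ∷ σ) (false ∷ τ) σ⊆τ = heft-mono σ τ (σ⊆τ ∘ suc)
heft-mono (false ∷ σ) (true ∷ τ) σ⊆τ = ℕ.m≤n⇒m≤1+n (heft-mono σ τ (σ⊆τ ∘ suc))
heft-mono (true ∷ σ) (true ∷ τ) σ⊆τ = s≤s (heft-mono σ τ (σ⊆τ ∘ suc))
heft-mono (true ∷ σ) (false ∷ τ) σ⊆τ with σ⊆τ zero refl
... | ()

-- For the minimality argument: `σ` will be the signs at a closest point and `τ` the chamber of heft
-- `k`. Inclusion of positive sets is expressed through `false` entries because those are the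
-- constraints that define the polyhedron.
heft-antisym : ∀ {n} (σ τ : Vec Bool n) → (∀ i → lookup τ i ≡ false → lookup σ i ≡ false) →
  heft τ ℕ.≤ heft σ → σ ≡ τ
heft-antisym [] [] _ _ = refl
heft-antisym (false ∷ σ) (false ∷ τ) σ⊆τ p = cong (false ∷_) (heft-antisym σ τ (σ⊆τ ∘ suc) p)
heft-antisym (false ∷ σ) (true ∷ τ) σ⊆τ p =
  ⊥-elim (ℕ.<-irrefl refl (ℕ.≤-trans p (heft-mono σ τ (σ⊆τ ∘ suc))))
heft-antisym (true ∷ σ) (true ∷ τ) σ⊆τ (s≤s p) = cong (true ∷_) (heft-antisym σ τ (σ⊆τ ∘ suc) p)
heft-antisym (true ∷ σ) (false ∷ τ) σ⊆τ p with σ⊆τ zero refl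
... | ()

-- Extremal points of the chambers of minimal heft.

module Chambers (F : RealField) {d n : ℕ}
  (g : Fin n → Arrangement.Pt F d) (c : Fin n → RealField.ℝ F) where
  open RealProperties F
  open Geometry F
  open Closest F
  open LinearAlgebra F
  open Solver using (solve; _:=_; _:+_; _:*_; :-_; con)

  Tight : Pt d → List (Fin n) → Set
  Tight y T = All (λ i → h g c i y ≡ 0r) T

  -- An affine cone with apex `y`, given by its points and not by directions. It involves all
  -- hyperplanes through `y`, so it depends on `y` alone and not on a chamber.
  Tangent : Pt d → Pt d → Set
  Tangent y z = ∀ i → h g c i y ≡ 0r → h g c i z ≤ᵣ 0r

  opaque
    -- First-order optimality. A small step from `y` towards `z` keeps the strict constraints by
    -- continuity and the tight ones because `z` is tangent. It changes the squared norm by t(2p +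
    -- tN), which is negative for small t if p < 0.
    closest⇒variational : ∀ {L y} → Closest g c L [] y → ∀ z → Tangent y z → 0r ≤ᵣ ⟨ y , z − y ⟩
    closest⇒variational {L} {y} (y∈L , _ , y-min) z z-tangent p<0 = contradict (Eventually-witness small)
      where
      w : Pt d
      w = z − y
      N p : ℝ
      N = ∥ w ∥²
      p = ⟨ y , w ⟩

      h-small : ∀ i → i ∈ L → Eventually (λ t → h g c i (y +[ t ] w) ≤ᵣ 0r)
      h-small i i∈L with <-tri (h g c i y) 0r
      ... | inj₁ hy<0 = Eventually-map (λ {t} _ q → <⇒≤ (subst (_<ᵣ 0r) (sym (h-segment g c i y z t)) q))
        (linear-eventually-neg hy<0 (h g c i z +ᵣ - h g c i y))
      ... | inj₂ (inj₁ hy≡0) = 1r , 0<1 , λ t 0<t t<1 → subst (_≤ᵣ 0r) (sym (h-segment g c i y z t))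
        (convex-nonpos (<⇒≤ 0<t) (<⇒≤ t<1) (≤-reflexive hy≡0) (z-tangent i hy≡0))
      ... | inj₂ (inj₂ 0<hy) = ⊥-elim (All.lookup y∈L i∈L 0<hy)

      small : Eventually (λ t → (∀ k → h g c (List.lookup L k) (y +[ t ] w) ≤ᵣ 0r) × (p +ᵣ p) +ᵣ t *ᵣ N <ᵣ 0r)
      small = Eventually-×
        (Eventually-∀ (length L) (λ k → h-small (List.lookup L k) (∈-lookup k)))
        (linear-eventually-neg (0<-x⇒x<0 (subst (0r <ᵣ_) (solve 1 (λ p → :- p :+ :- p := :- (p :+ p)) refl p)
          (+-pos (x<0⇒0<-x p<0) (x<0⇒0<-x p<0)))) N)

      contradict : ¬ (∃ λ t → 0r <ᵣ t ×
        (∀ k → h g c (List.lookup L k) (y +[ t ] w) ≤ᵣ 0r) × (p +ᵣ p) +ᵣ t *ᵣ N <ᵣ 0r)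
      contradict (t , 0<t , in-L , decrease) = y-min (y +[ t ] w) (All-lookup⁻ L in-L) []
        (0<y-x⇒x<y (subst (0r <ᵣ_)
          (trans (solve 4 (λ a p t m → t :* :- ((p :+ p) :+ t :* m)
                                  := a :+ :- (a :+ (t :+ t) :* p :+ t :* t :* m)) refl ∥ y ∥² p t N)
            (cong (λ a → ∥ y ∥² +ᵣ - a) (sym (norm-+ y w t))))
          (*-pos 0<t (x<0⇒0<-x decrease))))

  -- A hyperplane through `y` counts as negative, so this is the sign vector after pushing `y` to
  -- the negative side of all hyperplanes through it.
  signs : Pt d → Vec Bool n
  signs y = tabulate (λ i → does (0r <? h g c i y))

  signs-pos : ∀ {y} i → 0r <ᵣ h g c i y → lookup (signs y) i ≡ true
  signs-pos {y} i 0<h = trans (Vec.lookup∘tabulate _ i) (dec-true (0r <? h g c i y) 0<h)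

  signs-nonpos : ∀ {y} i → h g c i y ≤ᵣ 0r → lookup (signs y) i ≡ false
  signs-nonpos {y} i h≤0 = trans (Vec.lookup∘tabulate _ i) (dec-false (0r <? h g c i y) h≤0)

  signs-false⇒ : ∀ {y} i → lookup (signs y) i ≡ false → h g c i y ≤ᵣ 0r
  signs-false⇒ {y} i e 0<h with trans (sym e) (signs-pos {y} i 0<h)
  ... | ()

  signs-cong : ∀ {x y} → (∀ j → x j ≡ y j) → signs x ≡ signs y
  signs-cong e = Vec.tabulate-cong (λ i → cong (λ r → does (0r <? r)) (h-cong g c i e))

  module _ (1≤d : 1 ℕ.≤ d) (g≢0 : ∀ i → ¬ (∀ j → g i j ≡ 0r)) (generic : Generic d g c) where

    -- Genericity is applied with p = length T to the orthogonal complement of the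
    -- normals of T, or with p = d when T is longer than that.
    tight-independent : ∀ {y i T} → Unique (i ∷ T) → Tight y (i ∷ T) →
      ¬ (∀ z → Orthogonal g T z → ⟨ z , g i ⟩ ≡ 0r)
    -- `Generic` starts at p = 1, so a single normal is handled by `g≢0`: taking `z = g i` would
    -- make its norm zero.
    tight-independent {y} {i} {[]} _ _ dependent-i = g≢0 i (∥∥²≡0⇒≡0 (g i) (dependent-i (g i) []))
    tight-independent {y} {i} {T@(_ ∷ _)} unique tight dependent-i with length T ℕ.≤? d
    ... | yes q≤d = contained (orthogonal-complement (d ∸ q) (List.map g T)
        (ℕ.≤-reflexive (trans (cong (ℕ._+ (d ∸ q)) (List.length-map g T)) (ℕ.m+[n∸m]≡n q≤d))))
      where
      q : ℕ
      q = length T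
      contained : ¬ (∃ λ (v : Fin (d ∸ q) → Pt d) →
        (∀ k → ∥ v k ∥² ≢ 0r) × (∀ k → Orthogonal id (List.map g T) (v k)) × OrthogonalFamily v)
      contained (v , v≢0 , v⊥gT , v⊥v) = generic q (s≤s z≤n) q≤d y v (orthogonal⇒LinIndep v v≢0 v⊥v)
        (List.lookup (i ∷ T)) (Unique⇒lookup-injective unique)
        (λ t → All.lookup tight (∈-lookup t) , v⊥ t)
        where
        v⊥T : ∀ k → Orthogonal g T (v k)
        v⊥T k = All.map⁻ (v⊥gT k)
        v⊥ : ∀ t k → ⟨ v k , g (List.lookup (i ∷ T) t) ⟩ ≡ 0r
        v⊥ zero k = dependent-i (v k) (v⊥T k)
        v⊥ (suc t) k = All.lookup (v⊥T k) (∈-lookup t)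
    ... | no q≰d = generic d 1≤d ℕ.≤-refl y (λ _ _ → 0r) (λ _ _ → ⊥-elim ∘ no-vector)
        (λ t → List.lookup (i ∷ T) (Fin.inject≤ t 1+d≤1+q))
        (λ e → Fin.inject≤-injective 1+d≤1+q 1+d≤1+q _ _ (Unique⇒lookup-injective unique e))
        (λ t → All.lookup tight (∈-lookup (Fin.inject≤ t 1+d≤1+q)) , ⊥-elim ∘ no-vector)
      where
      1+d≤1+q : suc d ℕ.≤ suc (length T)
      1+d≤1+q = ℕ.m≤n⇒m≤1+n (ℕ.≰⇒> q≰d)
      no-vector : ¬ Fin (d ∸ d)
      no-vector k rewrite ℕ.n∸n≡0 d with k
      ... | ()

    opaque
      -- Induction on `T`: the component `e` of the new normal orthogonal to the earlier ones is
      -- nonzero by `tight-independent`. Adding a multiple of `e` adjusts the value at the new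
      -- normal and leaves the earlier values unchanged.
      descent-direction : ∀ {y T} → Unique T → Tight y T → ∃ λ u → All (λ i → ⟨ u , g i ⟩ <ᵣ 0r) T
      descent-direction {T = []} _ _ = (λ _ → 0r) , []
      descent-direction {y} {i ∷ T} unique@(_ ∷ unique-T) tight@(_ ∷ tight-T)
        with descent-direction unique-T tight-T | orthogonal-decomposition g T (g i)
      ... | u , u<0 | s , e⊥T , s∈T⊥⊥ = split (∥ e ∥² ≟ᵣ 0r)
        where
        e : Pt d
        e = g i − s

        ⟨z,g⟩≡⟨z,e⟩ : ∀ z → Orthogonal g T z → ⟨ z , g i ⟩ ≡ ⟨ z , e ⟩
        ⟨z,g⟩≡⟨z,e⟩ z z⊥T = sym (trans (⟨⟩-linearʳ z (g i) (- 1r) s)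
          (trans (cong (λ a → ⟨ z , g i ⟩ +ᵣ - 1r *ᵣ a) (s∈T⊥⊥ z z⊥T))
            (solve 1 (λ a → a :+ :- con (+ 1) :* con (+ 0) := a) refl ⟨ z , g i ⟩)))

        split : Dec (∥ e ∥² ≡ 0r) → ∃ λ u′ → All (λ i → ⟨ u′ , g i ⟩ <ᵣ 0r) (i ∷ T)
        split (yes e≡0) = ⊥-elim (tight-independent unique tight (λ z z⊥T →
          trans (⟨z,g⟩≡⟨z,e⟩ z z⊥T) (trans (⟨⟩-comm z e)
            (trans (⟨⟩-congˡ z (∥∥²≡0⇒≡0 e e≡0)) (⟨⟩-zeroˡ z)))))
        split (no e≢0) = u +[ τ ] e
          , subst (_<ᵣ 0r) (sym at-i) (0<-x⇒x<0 (subst (0r <ᵣ_) (solve 1 (λ a → a := :- (:- a)) refl 1r) 0<1))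
            ∷ All.zipWith (λ { {j} (u<0 , e⊥j) → subst (_<ᵣ 0r) (sym (trans (⟨⟩-linearˡ u τ e (g j))
                (trans (cong (λ a → ⟨ u , g j ⟩ +ᵣ τ *ᵣ a) e⊥j)
                  (solve 2 (λ a t → a :+ t :* con (+ 0) := a) refl ⟨ u , g j ⟩ τ)))) u<0 }) (u<0 , e⊥T)
          where
          a ν τ : ℝ
          a = ⟨ u , g i ⟩
          ν = inv ∥ e ∥² e≢0
          -- Solves a + τ∥e∥² = -1; here ⟨e, g i⟩ equals ∥e∥².
          τ = - ((a +ᵣ 1r) *ᵣ ν)
          at-i : ⟨ u +[ τ ] e , g i ⟩ ≡ - 1r
          at-i = trans (⟨⟩-linearˡ u τ e (g i))
            (trans (cong (λ b → a +ᵣ τ *ᵣ b) (⟨z,g⟩≡⟨z,e⟩ e e⊥T))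
            (trans (solve 3 (λ a i n → a :+ :- ((a :+ con (+ 1)) :* i) :* n := a :+ :- ((a :+ con (+ 1)) :* (i :* n)))
                  refl a ν ∥ e ∥²)
            (trans (cong (λ b → a +ᵣ - ((a +ᵣ 1r) *ᵣ b)) (inv-invˡ ∥ e ∥² e≢0))
              (solve 1 (λ a → a :+ :- ((a :+ con (+ 1)) :* con (+ 1)) := :- con (+ 1)) refl a))))

    opaque
      -- For small t, a step t along the descent direction preserves the nonzero signs at `y` and
      -- makes every zero negative, in agreement with the convention of `signs`.
      signs-chamber : ∀ y → IsChamber g c (signs y)
      signs-chamber y = perturb (descent-direction {y} {T} (Unique.filter⁺ tight? (Unique.allFin⁺ n))
            (All.all-filter tight? (allFin n)))
        where
        tight? : ∀ i → Dec (h g c i y ≡ 0r)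
        tight? i = h g c i y ≟ᵣ 0r
        T : List (Fin n)
        T = filter tight? (allFin n)

        perturb : (∃ λ u → All (λ i → ⟨ u , g i ⟩ <ᵣ 0r) T) → IsChamber g c (signs y)
        perturb (u , u<0) = pick (Eventually-witness (Eventually-∀ n side))
          where
          pick : (∃ λ t → 0r <ᵣ t × (∀ i → SideOf (lookup (signs y) i) (h g c i y +ᵣ t *ᵣ ⟨ u , g i ⟩))) →
            IsChamber g c (signs y)
          pick (t , _ , sides) = y +[ t ] u , λ i → subst (SideOf (lookup (signs y) i))
                (sym (h-+ g c i y t u)) (sides i)

          side : ∀ i → Eventually (λ t → SideOf (lookup (signs y) i) (h g c i y +ᵣ t *ᵣ ⟨ u , g i ⟩))
          side i with <-tri (h g c i y) 0r
          ... | inj₁ h<0 rewrite signs-nonpos {y} i (<⇒≤ h<0) = linear-eventually-neg h<0 ⟨ u , g i ⟩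
          ... | inj₂ (inj₂ 0<h) rewrite signs-pos {y} i 0<h = linear-eventually-pos 0<h ⟨ u , g i ⟩
          ... | inj₂ (inj₁ h≡0) rewrite signs-nonpos {y} i (≤-reflexive h≡0) =
            1r , 0<1 , λ t 0<t _ → 0<-x⇒x<0 (subst (0r <ᵣ_)
                (trans (solve 2 (λ t b → t :* :- b := :- (con (+ 0) :+ t :* b)) refl t ⟨ u , g i ⟩)
                  (cong (λ a → - (a +ᵣ t *ᵣ ⟨ u , g i ⟩)) (sym h≡0)))
                (*-pos 0<t (x<0⇒0<-x (All.lookup u<0 (∈-filter⁺ tight? (∈-allFin i) h≡0)))))

    module _ {k : ℕ} (k≤heft : ∀ σ → IsChamber g c σ → k ℕ.≤ heft σ) where

      opaque
        extremal-point : ∀ {σ} → IsChamber g c σ → heft σ ≡ k →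
          ∃ λ y → signs y ≡ σ × (∀ z → Tangent y z → 0r ≤ᵣ ⟨ y , z − y ⟩)
        extremal-point {σ} (x , x∈σ) heft≡k with closest g c L [] x∈L []
          where
          negative? : ∀ i → Dec (lookup σ i ≡ false)
          negative? i = lookup σ i Bool.≟ false
          L : List (Fin n)
          L = filter negative? (allFin n)
          x∈L : Inequalities g c L x
          x∈L = All.map (λ {i} σi≡false → <⇒≤ (subst (λ b → SideOf b (h g c i x)) σi≡false (x∈σ i)))
            (All.all-filter negative? (allFin n))
        ... | y , y-closest@(y∈L , _ , _) = y
          -- Every function negative on the chamber is nonpositive at `y`, so the positive set at
          -- `y` is contained in that of `σ`. As `signs y` is itself a chamber, its heft is at least
          -- `k`, and the two sets coincide.
          , heft-antisym (signs y) σ (λ i σi≡false → signs-nonpos {y} i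
              (All.lookup y∈L (∈-filter⁺ (λ i → lookup σ i Bool.≟ false) (∈-allFin i) σi≡false)))
              (subst (ℕ._≤ heft (signs y)) (sym heft≡k) (k≤heft (signs y) (signs-chamber y)))
          , closest⇒variational y-closest

-- The dimension of the space of polynomials of degree at most k in d variables.
dim : ℕ → ℕ → ℕ
dim zero k = 1
dim (suc d) zero = 1
dim (suc d) (suc k) = dim d (suc k) + dim (suc d) k

-- The recursion of `dim` is Pascal's rule.
dim≡C : ∀ d k → dim d k ≡ (d + k) C d
dim≡C zero k = refl
dim≡C (suc d) zero = sym (trans (cong (_C suc d) (ℕ.+-identityʳ (suc d))) (nCn≡1 (suc d)))
dim≡C (suc d) (suc k) = begin
  dim d (suc k) + dim (suc d) k                    ≡⟨ cong₂ _+_ (dim≡C d (suc k)) (dim≡C (suc d) k) ⟩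
  (d + suc k) C d + (suc d + k) C suc d            ≡⟨ cong (λ m → (d + suc k) C d + m C suc d) (sym (ℕ.+-suc d k)) ⟩
  (d + suc k) C d + (d + suc k) C suc d            ≡⟨ nCk+nC[k+1]≡[n+1]C[k+1] (d + suc k) d ⟩
  (suc d + suc k) C suc d                          ∎
  where open ≡-Reasoning

-- Polynomial functions of bounded degree as coefficient vectors.

module Polynomials (F : RealField) where
  open RealProperties F
  open Geometry F
  open Solver using (solve; _:=_; _:+_; _:*_; :-_; con)
  open ≡-Reasoning

  -- The coefficients of p(x₁,…,x_d) + x₀ r(x₀,…,x_d) are those of p followed by those of r.
  eval : ∀ d k → Pt (dim d k) → Pt d → ℝ
  eval zero k q x = q zero
  eval (suc d) zero q x = q zero
  eval (suc d) (suc k) q x =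
    eval d (suc k) (q ∘ (_↑ˡ dim (suc d) k)) (x ∘ suc) +ᵣ
    x zero *ᵣ eval (suc d) k (q ∘ (dim d (suc k) ↑ʳ_)) x

  eval-cong : ∀ d k {q r : Pt (dim d k)} → (∀ i → q i ≡ r i) → ∀ x → eval d k q x ≡ eval d k r x
  eval-cong zero k e x = e zero
  eval-cong (suc d) zero e x = e zero
  eval-cong (suc d) (suc k) e x = cong₂ (λ a b → a +ᵣ x zero *ᵣ b)
    (eval-cong d (suc k) (e ∘ (_↑ˡ dim (suc d) k)) (x ∘ suc)) (eval-cong (suc d) k (e ∘ (dim d (suc k) ↑ʳ_)) x)

  eval-linear : ∀ d k (q : Pt (dim d k)) t r x → eval d k (q +[ t ] r) x ≡ eval d k q x +ᵣ t *ᵣ eval d k r x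
  eval-linear zero k q t r x = refl
  eval-linear (suc d) zero q t r x = refl
  eval-linear (suc d) (suc k) q t r x = trans
    (cong₂ (λ a b → a +ᵣ x zero *ᵣ b)
      (eval-linear d (suc k) (q ∘ (_↑ˡ dim (suc d) k)) t (r ∘ (_↑ˡ dim (suc d) k)) (x ∘ suc))
      (eval-linear (suc d) k (q ∘ (dim d (suc k) ↑ʳ_)) t (r ∘ (dim d (suc k) ↑ʳ_)) x))
    (solve 6 (λ a b a′ b′ t x → (a :+ t :* b) :+ x :* (a′ :+ t :* b′) := (a :+ x :* a′) :+ t :* (b :+ x :* b′))
      refl _ _ _ _ t (x zero))

  eval-zero : ∀ d k x → eval d k (λ _ → 0r) x ≡ 0r
  eval-zero zero k x = refl
  eval-zero (suc d) zero x = refl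
  eval-zero (suc d) (suc k) x = trans
    (cong₂ (λ a b → a +ᵣ x zero *ᵣ b) (eval-zero d (suc k) (x ∘ suc)) (eval-zero (suc d) k x))
    (solve 1 (λ x → con (+ 0) :+ x :* con (+ 0) := con (+ 0)) refl (x zero))

  eval-constant : ∀ d a x → eval d 0 (λ _ → a) x ≡ a
  eval-constant zero a x = refl
  eval-constant (suc d) a x = refl

  -- Evaluation is linear in the coefficients, so a relation that `dependent` finds among
  -- coefficient vectors holds between the values at every point.
  eval-dependent : ∀ d k {m} (a : Fin m → ℝ) (q : Fin m → Pt (dim d k)) →
    (∀ i → Σ[ m ] (λ j → a j *ᵣ q j i) ≡ 0r) → ∀ x → Σ[ m ] (λ j → a j *ᵣ eval d k (q j) x) ≡ 0r
  eval-dependent zero k a q relation x = relation zero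
  eval-dependent (suc d) zero a q relation x = relation zero
  eval-dependent (suc d) (suc k) {m} a q relation x = begin
    Σ[ m ] (λ j → a j *ᵣ (p j +ᵣ x zero *ᵣ r j))
      ≡⟨ Σ-cong m (λ j → solve 4 (λ a p x r → a :* (p :+ x :* r) := a :* p :+ x :* (a :* r))
            refl (a j) (p j) (x zero) (r j)) ⟩
    Σ[ m ] (λ j → a j *ᵣ p j +ᵣ x zero *ᵣ (a j *ᵣ r j))
      ≡⟨ Σ-+ m _ _ ⟩
    Σ[ m ] (λ j → a j *ᵣ p j) +ᵣ Σ[ m ] (λ j → x zero *ᵣ (a j *ᵣ r j))
      ≡⟨ cong₂ _+ᵣ_
           (eval-dependent d (suc k) a (λ j → q j ∘ (_↑ˡ dim (suc d) k)) (relation ∘ (_↑ˡ dim (suc d) k)) (x ∘ suc))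
           (trans (Σ-*ˡ m (x zero) _) (cong (x zero *ᵣ_)
             (eval-dependent (suc d) k a (λ j → q j ∘ (dim d (suc k) ↑ʳ_)) (relation ∘ (dim d (suc k) ↑ʳ_)) x))) ⟩
    0r +ᵣ x zero *ᵣ 0r
      ≡⟨ solve 1 (λ x → con (+ 0) :+ x :* con (+ 0) := con (+ 0)) refl (x zero) ⟩
    0r ∎
    where
    p r : Fin m → ℝ
    p j = eval d (suc k) (q j ∘ (_↑ˡ dim (suc d) k)) (x ∘ suc)
    r j = eval (suc d) k (q j ∘ (dim d (suc k) ↑ʳ_)) x

  IsPolynomial : ∀ d → ℕ → (Pt d → ℝ) → Set
  IsPolynomial d k f = ∃ λ q → ∀ x → f x ≡ eval d k q x

  IsPolynomial-cong : ∀ {d k} {f f′ : Pt d → ℝ} → (∀ x → f′ x ≡ f x) → IsPolynomial d k f → IsPolynomial d k f′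
  IsPolynomial-cong e (q , f≡q) = q , λ x → trans (e x) (f≡q x)

  IsPolynomial-+ : ∀ {d k f f′} t → IsPolynomial d k f → IsPolynomial d k f′ →
        IsPolynomial d k (λ x → f x +ᵣ t *ᵣ f′ x)
  IsPolynomial-+ {d} {k} t (q , f≡q) (r , f′≡r) = q +[ t ] r , λ x →
    trans (cong₂ (λ a b → a +ᵣ t *ᵣ b) (f≡q x) (f′≡r x)) (sym (eval-linear d k q t r x))

  IsPolynomial-join : ∀ {d k f f′} → IsPolynomial d (suc k) f → IsPolynomial (suc d) k f′ →
    IsPolynomial (suc d) (suc k) (λ x → f (x ∘ suc) +ᵣ x zero *ᵣ f′ x)
  IsPolynomial-join {d} {k} (q , f≡q) (r , f′≡r) = q ++ r , λ x → cong₂ (λ a b → a +ᵣ x zero *ᵣ b)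
    (trans (f≡q (x ∘ suc)) (eval-cong d (suc k) (sym ∘ lookup-++ˡ q r) (x ∘ suc)))
    (trans (f′≡r x) (eval-cong (suc d) k (sym ∘ lookup-++ʳ q r) x))

  IsPolynomial-lift : ∀ {d k f} → IsPolynomial d (suc k) f → IsPolynomial (suc d) (suc k) (λ x → f (x ∘ suc))
  IsPolynomial-lift {d} {k} {f} p = IsPolynomial-cong
    (λ x → solve 2 (λ a x → a := a :+ x :* con (+ 0)) refl (f (x ∘ suc)) (x zero))
    (IsPolynomial-join {f = f} p ((λ _ → 0r) , λ x → sym (eval-zero (suc d) k x)))

  -- With s the part of ⟨x, v⟩ beyond the first variable, (x₀v₀ + s + b)(p + x₀r) = (s + b)p +
  -- x₀((x₀v₀ + s + b)r + v₀p). The first product has one variable fewer, and the one with r has a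
  -- factor of lower degree bound, so both are covered by recursion; this grouping is the shape that
  -- `IsPolynomial-join` builds.
  eval-*-affine : ∀ d k (v : Pt d) b q → IsPolynomial d (suc k) (λ x → (⟨ x , v ⟩ +ᵣ b) *ᵣ eval d k q x)
  eval-*-affine zero k v b q = (λ _ → b *ᵣ q zero) , λ x → cong (_*ᵣ q zero) (+-idˡ b)
  eval-*-affine (suc d) zero v b q = IsPolynomial-cong
    (λ x → trans
      (solve 5 (λ x v s b q → ((x :* v :+ s) :+ b) :* q := (s :+ b) :* q :+ x :* (v :* q)) refl
        (x zero) (v zero) ⟨ x ∘ suc , v ∘ suc ⟩ b (q zero))
      (cong (λ a → (⟨ x ∘ suc , v ∘ suc ⟩ +ᵣ b) *ᵣ a +ᵣ x zero *ᵣ (v zero *ᵣ q zero))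
        (sym (eval-constant d (q zero) (x ∘ suc)))))
    (IsPolynomial-join {f = λ x → (⟨ x , v ∘ suc ⟩ +ᵣ b) *ᵣ eval d 0 (λ _ → q zero) x}
      (eval-*-affine d zero (v ∘ suc) b (λ _ → q zero)) ((λ _ → v zero *ᵣ q zero) , λ x → refl))
  eval-*-affine (suc d) (suc k) v b q = IsPolynomial-cong
    (λ x → solve 6 (λ x v s b p r → ((x :* v :+ s) :+ b) :* (p :+ x :* r)
                := (s :+ b) :* p :+ x :* (((x :* v :+ s) :+ b) :* r :+ v :* p)) refl
      (x zero) (v zero) ⟨ x ∘ suc , v ∘ suc ⟩ b (eval d (suc k) p (x ∘ suc)) (eval (suc d) k r x))
    (IsPolynomial-join {f = λ x → (⟨ x , v ∘ suc ⟩ +ᵣ b) *ᵣ eval d (suc k) p x}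
      (eval-*-affine d (suc k) (v ∘ suc) b p)
      (IsPolynomial-+ (v zero) (eval-*-affine (suc d) k v b r)
        (IsPolynomial-lift {f = eval d (suc k) p} (p , λ _ → refl))))
    where
    p : Pt (dim d (suc k))
    p = q ∘ (_↑ˡ dim (suc d) k)
    r : Pt (dim (suc d) k)
    r = q ∘ (dim d (suc k) ↑ʳ_)

  -- The f_A of the overview when `r i` is the value of the i-th affine function.
  positiveProduct : ∀ {n} → Vec Bool n → (Fin n → ℝ) → ℝ
  positiveProduct [] r = 1r
  positiveProduct (true ∷ σ) r = r zero *ᵣ positiveProduct σ (r ∘ suc)
  positiveProduct (false ∷ σ) r = positiveProduct σ (r ∘ suc)

  positiveProduct-pos : ∀ {n} (σ : Vec Bool n) {r} → (∀ i → lookup σ i ≡ true → 0r <ᵣ r i) → 0r <ᵣ positiveProduct σ r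
  positiveProduct-pos [] p = 0<1
  positiveProduct-pos (true ∷ σ) p = *-pos (p zero refl) (positiveProduct-pos σ (p ∘ suc))
  positiveProduct-pos (false ∷ σ) p = positiveProduct-pos σ (p ∘ suc)

  positiveProduct-zero : ∀ {n} (σ : Vec Bool n) {r} i → lookup σ i ≡ true → r i ≡ 0r → positiveProduct σ r ≡ 0r
  positiveProduct-zero (true ∷ σ) {r} zero _ e = trans (cong (_*ᵣ positiveProduct σ (r ∘ suc)) e) (zeroˡ _)
  positiveProduct-zero (true ∷ σ) {r} (suc i) σi e =
    trans (cong (r zero *ᵣ_) (positiveProduct-zero σ i σi e)) (zeroʳ _)
  positiveProduct-zero (false ∷ σ) (suc i) σi e = positiveProduct-zero σ i σi e

  positiveProduct-IsPolynomial : ∀ {d n} (σ : Vec Bool n) (g : Fin n → Pt d) (c : Fin n → ℝ) →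
    IsPolynomial d (heft σ) (λ x → positiveProduct σ (λ i → h g c i x))
  positiveProduct-IsPolynomial {d} [] g c = (λ _ → 1r) , λ x → sym (eval-constant d 1r x)
  positiveProduct-IsPolynomial (false ∷ σ) g c = positiveProduct-IsPolynomial σ (g ∘ suc) (c ∘ suc)
  positiveProduct-IsPolynomial {d} (true ∷ σ) g c with positiveProduct-IsPolynomial σ (g ∘ suc) (c ∘ suc)
  ... | q , f≡q = IsPolynomial-cong (λ x → cong (h g c zero x *ᵣ_) (f≡q x))
    (eval-*-affine d (heft σ) (g zero) (c zero) q)

  argmax : ∀ {m} {P : Fin m → Set} → (∀ j → Dec (P j)) → (D : Fin m → ℝ) → ∃ P →
    ∃ λ j → P j × (∀ l → P l → D l ≤ᵣ D j)
  argmax {suc m} P? D (j , Pj) with P? zero | Fin.any? (P? ∘ suc)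
  argmax P? D (zero , P₀) | no ¬P₀ | no _ = ⊥-elim (¬P₀ P₀)
  argmax P? D (suc j , Pj) | _ | no none = ⊥-elim (none (j , Pj))
  argmax P? D (zero , _) | yes P₀ | no none =
    zero , P₀ , λ { zero _ → <-irrefl _ ; (suc l) Pl → ⊥-elim (none (l , Pl)) }
  argmax P? D _ | P₀? | yes some with argmax (P? ∘ suc) (D ∘ suc) some | P₀?
  ... | j , Pj , j-max | no ¬P₀ = suc j , Pj , λ { zero P₀ → ⊥-elim (¬P₀ P₀) ; (suc l) Pl → j-max l Pl }
  ... | j , Pj , j-max | yes P₀ with D (suc j) <? D zero
  ...   | no D₀≤Dj = suc j , Pj , λ { zero _ → D₀≤Dj ; (suc l) Pl → j-max l Pl }
  ...   | yes Dj<D₀ = zero , P₀ , λ { zero _ → <-irrefl _ ; (suc l) Pl → ≤-trans (j-max l Pl) (<⇒≤ Dj<D₀) }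

-- The triangular system and the dimension count.

module Counting (F : RealField) {d n k : ℕ}
  (g : Fin n → Arrangement.Pt F d) (c : Fin n → RealField.ℝ F) where
  open RealProperties F
  open Geometry F
  open LinearAlgebra F
  open Polynomials F
  open Chambers F g c
  open Solver using (solve; _:=_; _:+_; _:*_; :-_; con)
  open ≡-Reasoning

  -- By `norm-difference`, ∥y - x∥² = ∥y∥² - ∥x∥² - 2⟨x, y - x⟩, which the hypotheses make
  -- nonpositive.
  variational⇒unique : {x y : Pt d} → 0r ≤ᵣ ⟨ x , y − x ⟩ → ∥ y ∥² ≤ᵣ ∥ x ∥² → ∀ j → y j ≡ x j
  variational⇒unique {x} {y} 0≤p y≤x = x−y≡0⇒x≡y y x (∥∥²≡0⇒≡0 (y − x)
    (≤-antisym (0≤y-x⇒x≤y (subst (0r ≤ᵣ_) gap (+-nonneg (x≤y⇒0≤y-x y≤x) (+-nonneg 0≤p 0≤p)))) (∥∥²-nonneg (y − x))))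
    where
    gap : (∥ x ∥² +ᵣ - ∥ y ∥²) +ᵣ (⟨ x , y − x ⟩ +ᵣ ⟨ x , y − x ⟩) ≡ 0r +ᵣ - ∥ y − x ∥²
    gap = trans (cong (λ a → (∥ x ∥² +ᵣ - a) +ᵣ (⟨ x , y − x ⟩ +ᵣ ⟨ x , y − x ⟩)) (norm-difference x y))
      (solve 3 (λ n p m → (n :+ :- (n :+ (con (+ 1) :+ con (+ 1)) :* p :+ m)) :+ (p :+ p) := con (+ 0) :+ :- m)
        refl ∥ x ∥² ⟨ x , y − x ⟩ ∥ y − x ∥²)

  -- Evaluated at the point of largest norm among those with nonzero coefficient, a linear
  -- relation between the products keeps only one term.
  chambers-bounded : (cs : List (Vec Bool n)) → Unique cs → (∀ j → heft (List.lookup cs j) ≡ k) →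
    (∀ j → ∃ λ y → signs y ≡ List.lookup cs j × (∀ z → Tangent y z → 0r ≤ᵣ ⟨ y , z − y ⟩)) →
    length cs ≤ dim d k
  chambers-bounded cs unique heft≡k extremal with length cs ℕ.≤? dim d k
  ... | yes m≤dim = m≤dim
  ... | no m≰dim = ⊥-elim (refute (dependent (ℕ.≰⇒> m≰dim) q))
    where
    m : ℕ
    m = length cs

    σ : Fin m → Vec Bool n
    σ = List.lookup cs

    y : Fin m → Pt d
    y j = proj₁ (extremal j)

    signs-y : ∀ j → signs (y j) ≡ σ j
    signs-y j = proj₁ (proj₂ (extremal j))

    f : Fin m → Pt d → ℝ
    f j x = positiveProduct (σ j) (λ i → h g c i x)

    polynomial : ∀ j → IsPolynomial d k (f j)
    polynomial j = subst (λ k → IsPolynomial d k (f j)) (heft≡k j) (positiveProduct-IsPolynomial (σ j) g c)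

    q : Fin m → Pt (dim d k)
    q j = proj₁ (polynomial j)

    σ-false⇒ : ∀ j i → lookup (σ j) i ≡ false → h g c i (y j) ≤ᵣ 0r
    σ-false⇒ j i e = signs-false⇒ {y j} i (trans (cong (λ τ → lookup τ i) (signs-y j)) e)

    σ-true⇒ : ∀ j i → lookup (σ j) i ≡ true → 0r <ᵣ h g c i (y j)
    σ-true⇒ j i e with 0r <? h g c i (y j)
    ... | yes 0<h = 0<h
    ... | no h≤0 with trans (sym e) (trans (cong (λ τ → lookup τ i) (sym (signs-y j))) (signs-nonpos {y j} i h≤0))
    ...   | ()

    -- Either the product has a zero factor at `y j`, or `y l` is tangent at `y j`. In the second
    -- case `variational⇒unique` makes the two points equal, hence also their sign vectors, contrary
    -- to `l ≢ j`.
    off-diagonal : ∀ j l → ∥ y l ∥² ≤ᵣ ∥ y j ∥² → l ≢ j → f l (y j) ≡ 0r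
    off-diagonal j l l≤j l≢j
      with Fin.any? (λ i → (lookup (σ l) i Bool.≟ true) ×-dec (h g c i (y j) ≟ᵣ 0r))
    ... | yes (i , σi≡true , h≡0) = positiveProduct-zero (σ l) i σi≡true h≡0
    ... | no none = ⊥-elim (l≢j (Unique⇒lookup-injective unique (begin
      σ l           ≡⟨ sym (signs-y l) ⟩
      signs (y l)   ≡⟨ signs-cong (variational⇒unique (proj₂ (proj₂ (extremal j)) (y l) tangent) l≤j) ⟩
      signs (y j)   ≡⟨ signs-y j ⟩
      σ j           ∎)))
      where
      tangent : Tangent (y j) (y l)
      -- A function vanishing at `y j` is not a factor of `f l` here, so its sign in `σ l` is
      -- `false` and it is nonpositive at `y l`.
      tangent i h≡0 = σ-false⇒ l i (Bool.¬-not (λ σi≡true → none (i , σi≡true , h≡0)))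

    refute : ¬ (∃ λ (a : Pt m) → (∃ λ j → a j ≢ 0r) × (∀ i → Σ[ m ] (λ j → a j *ᵣ q j i) ≡ 0r))
    refute (a , a≢0 , relation) with argmax (λ j → ¬? (a j ≟ᵣ 0r)) (λ j → ∥ y j ∥²) a≢0
    -- The diagonal value `f j (y j)` is positive, because all its factors are positive at `y j`;
    -- the relation evaluated at `y j` would make it zero.
    ... | j , aj≢0 , j-max = pos⇒≢0 (positiveProduct-pos (σ j) (σ-true⇒ j)) (*-zero⇒ (begin
        a j *ᵣ f j (y j)                          ≡⟨ sym (Σ-single m j vanish) ⟩
        Σ[ m ] (λ l → a l *ᵣ f l (y j))           ≡⟨ Σ-cong m (λ l → cong (a l *ᵣ_) (proj₂ (polynomial l) (y j))) ⟩
        Σ[ m ] (λ l → a l *ᵣ eval d k (q l) (y j)) ≡⟨ eval-dependent d k a q relation (y j) ⟩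
        0r                                        ∎) aj≢0)
      where
      vanish : ∀ l → l ≢ j → a l *ᵣ f l (y j) ≡ 0r
      vanish l l≢j with a l ≟ᵣ 0r
      ... | yes al≡0 = trans (cong (_*ᵣ f l (y j)) al≡0) (zeroˡ _)
      ... | no al≢0 = trans (cong (a l *ᵣ_) (off-diagonal j l (j-max l al≢0) l≢j)) (zeroʳ (a l))

theorem14 : (F : RealField) → let open RealField F in let open Arrangement F in
    (d n k : ℕ) → 1 ≤ d →
    (g : Fin n → Pt d) (c : Fin n → ℝ) →
    (∀ i → ¬ (∀ j → g i j ≡ 0r)) →
    Generic d g c →
    (∀ (σ : Vec Bool n) → IsChamber g c σ → k ≤ heft σ) →
    (cs : List (Vec Bool n)) → Unique cs →
    All (λ σ → IsChamber g c σ × heft σ ≡ k) cs →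
    length cs ≤ (d + k) C d
theorem14 F d n k 1≤d g c g≢0 generic k≤heft cs unique chambers =
  subst (length cs ≤_) (dim≡C d k) (chambers-bounded cs unique (proj₂ ∘ chamber)
    (λ j → extremal-point 1≤d g≢0 generic k≤heft (proj₁ (chamber j)) (proj₂ (chamber j))))
  where
  open Arrangement F
  open Chambers F g c
  open Counting F {k = k} g c
  chamber : ∀ j → IsChamber g c (List.lookup cs j) × heft (List.lookup cs j) ≡ k
  chamber j = All.lookup chambers (∈-lookup j)
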